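{- For every integer $k \geq 2$ there exist constants $C_k, c_k > 0$ such that the following holds. For any $k$-uniform $k$-partite hypergraph $H$ with at least two edges, the Tur\'an number of $H$ satisfies \[\Omega_k\left(n^{k-\frac{C_k}{d_1(H)}}\right) \leq \mathrm{ex}(n,H) \leq O_H\left(n^{k-\frac{c_k}{d_1(H)^{k-1}}}\right).\]
   Context: For a $k$-uniform hypergraph $H$, the Tur\'an number $\mathrm{ex}(n,H)$ is the maximum number of edges in a $k$-uniform hypergraph on $n$ vertices containing no copy of $H$. A hypergraph is $k$-partite if its vertex set can be partitioned into $k$ parts so that each edge has exactly one vertex in each part. For $0 \le i < k$, the $i$-skeleton $H^{(i)}$ of $H$ is the $(i+1)$-uniform hypergraph on $V(H)$ whose edges are all $(i+1)$-sets contained in some edge of $H$. The $i$-th skeletal degeneracy $d_i(H)$ is the degeneracy of $H^{(i)}$, i.e. the least $d$ such that every subhypergraph of $H^{(i)}$ has minimum degree at most $d$; $d_1(H)$ (the degeneracy of the graph obtained by replacing each edge of $H$ by a $k$-clique) is called the skeletal degeneracy. $\Omega_k(f(n))$ denotes a quantity at least $c f(n)$ for some $c>0$ depending only on $k$ and all sufficiently large $n$; $O_H(f(n))$ denotes a quantity at most $C f(n)$ for some $C$ depending only on $H$. -}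

module Defs where

open import Data.Nat using (ℕ; zero; suc; _+_; _*_; _^_; _≤_)
open import Data.Bool using (Bool; true; false; _∧_; not; if_then_else_)
open import Data.Fin using (Fin)
open import Data.Fin.Properties using () renaming (_≟_ to _≟F_)
open import Data.Fin.Subset using (Subset; _∈_; ∣_∣; Nonempty)
open import Data.List using (List; length; map; allFin)
open import Data.Bool.ListAction using (any)
open import Data.Nat.ListAction using (sum)
open import Data.List.Membership.Propositional using () renaming (_∈_ to _∈ₗ_)
open import Data.List.Relation.Unary.All using (All)
open import Data.List.Relation.Unary.Unique.Propositional using (Unique)
open import Data.Vec using (lookup)
open import Data.Product using (Σ; ∃; _×_)
open import Function.Bundles using (_⇔_)
open import Function.Definitions using (Injective)
open import Relation.Binary.PropositionalEquality using (_≡_)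
open import Relation.Nullary.Decidable using (⌊_⌋)

record Hypergraph (k m : ℕ) : Set where
  field
    edges    : List (Subset m)
    uniform  : All (λ e → ∣ e ∣ ≡ k) edges
    distinct : Unique edges
open Hypergraph public

e[_] : ∀ {k m} → Hypergraph k m → ℕ
e[ H ] = length (edges H)

KPartite : ∀ {k m} → Hypergraph k m → Set
KPartite {k} {m} H =
  Σ (Fin m → Fin k) λ part →
    ∀ e → e ∈ₗ edges H → ∀ (j : Fin k) →
      ∃ λ (i : Fin m) → i ∈ e × part i ≡ j ×
        (∀ i' → i' ∈ e → part i' ≡ j → i' ≡ i)

Contains : ∀ {k n m} → Hypergraph k n → Hypergraph k m → Set
Contains {k} {n} {m} G H =
  Σ (Fin m → Fin n) λ φ → Injective _≡_ _≡_ φ ×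
    (∀ e → e ∈ₗ edges H →
      ∃ λ e' → e' ∈ₗ edges G × (∀ (j : Fin n) → (j ∈ e') ⇔ (∃ λ i → i ∈ e × φ i ≡ j)))

HFree : ∀ {k n m} → Hypergraph k m → Hypergraph k n → Set
HFree H G = Contains G H → Data.Empty.⊥
  where import Data.Empty

IsEx : ∀ {k m} → ℕ → Hypergraph k m → ℕ → Set
IsEx {k} n H t =
  (∃ λ (G : Hypergraph k n) → HFree H G × e[ G ] ≡ t) ×
  (∀ (G : Hypergraph k n) → HFree H G → e[ G ] ≤ t)

adj₁ : ∀ {k m} → Hypergraph k m → Fin m → Fin m → Bool
adj₁ H u v = not ⌊ u ≟F v ⌋ ∧ any (λ e → lookup e u ∧ lookup e v) (edges H)

deg₁ : ∀ {k m} → Hypergraph k m → Subset m → Fin m → ℕ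
deg₁ {m = m} H S v =
  sum (map (λ u → if lookup S u ∧ adj₁ H u v then 1 else 0) (allFin m))

DegenerateBy₁ : ∀ {k m} → Hypergraph k m → ℕ → Set
DegenerateBy₁ {m = m} H d =
  ∀ (S : Subset m) → Nonempty S → ∃ λ v → v ∈ S × deg₁ H S v ≤ d

IsSkelDeg : ∀ {k m} → Hypergraph k m → ℕ → Set
IsSkelDeg H d = DegenerateBy₁ H d × (∀ d' → DegenerateBy₁ H d' → d ≤ d')

{-# OPTIONS --safe #-}

-- Lower bound. H contains a set S inside which every vertex has at least d skeletal neighbours. Keep each
-- ordered pair of vertices with probability 1 / L, where L ^ d ≈ n ^ 2, and take the k-sets all of whose pairs
-- are kept. A copy of S needs d |S| pairs, so the expected number of copies is at most n ^ (- |S|), while a k-set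
-- survives with probability at least L ^ (- k ^ 2). For d ≥ 4 k ^ 2 the k-sets dominate; a smaller d is absorbed
-- into the exponent C_k.
--
-- Upper bound. View a hypergraph as a relation E on ordered k-tuples. Process the coordinates one at a time: for
-- the coordinate i sample T = (y₁ , … , y_t) and keep the tuples x ∈ E such that replacing x_i by any y ∈ T
-- stays in E. A family of tuples whose coordinates off i lie among D vertices and which has few common
-- completions at i is unlikely to survive, and there are only O (n ^ D) such families, so t = O (D) suffices even
-- though a family has up to D ^ (k - 1) members. Expansion at an earlier coordinate survives if it was arranged
-- for D + t vertices, because T can be appended to them. The density exponent is multiplied by O (D) at each
-- step, and the last step only has to leave a tuple alive; this gives D ^ (k - 1). Then H is embedded along a
-- degenerate ordering, starting with every vertex at the entries of one tuple of E, which is why D = d + k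
-- vertices suffice.

module Submission where

open import Defs
open import Data.Bool.Base using (Bool; true; false; _∧_; if_then_else_)
open import Data.Bool.ListAction using (any)
import Data.Bool.Properties as Bool
open import Data.Fin.Base using (Fin; zero; suc; combine; fromℕ<; remQuot)
import Data.Fin.Properties as Fin
open import Data.Fin.Subset using (Subset; _∈_; _∉_; _⊆_; _-_; ∣_∣; inside; outside; Nonempty; ⊥) renaming (⊤ to full)
open import Data.Fin.Subset.Properties as Sub using
  (_⊆?_; nonempty?; anySubset?; x∈p∧x≢y⇒x∈p-y; x∈p⇒∣p-x∣<∣p∣; p─q⊆p; ∈⊤; ∣⊤∣≡n; ∣⊥∣≡0; ⊆-antisym)
open import Data.List.Base as List using (List; []; _∷_; _++_; length; allFin; concatMap; filter; cartesianProduct)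
open import Data.List.Membership.Propositional using () renaming (_∈_ to _∈ₗ_; _∉_ to _∉ₗ_; lose to loseₗ)
import Data.List.Membership.DecPropositional as DecMem
open import Data.List.Membership.Propositional.Properties using
  (∈-map⁺; ∈-map⁻; ∈-++⁺ˡ; ∈-++⁺ʳ; ∈-concatMap⁺; ∈-filter⁺; ∈-filter⁻; ∈-allFin; ∈-cartesianProduct⁺)
open import Data.List.Properties as List using (length-++; length-map; length-tabulate; length-filter)
open import Data.List.Relation.Unary.All as All using (All; []; _∷_)
import Data.List.Relation.Unary.All.Properties as AllP
open import Data.List.Relation.Unary.AllPairs using ([]; _∷_)
open import Data.List.Relation.Unary.Any as Any using (Any; here; there; any?; satisfied)
open import Data.List.Relation.Unary.Unique.Propositional using (Unique)
import Data.List.Relation.Unary.Unique.Propositional.Properties as Uniq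
open import Data.Nat.Base
open import Data.Nat.DivMod using (m≡m%n+[m/n]*n; m%n<n; m/n*n≤m; m≥n⇒m/n>0)
open import Data.Nat.ListAction using (sum)
open import Data.Nat.Properties
open import Data.Nat.Tactic.RingSolver using (solve-∀)
open import Data.Product using (Σ; ∃; _×_; _,_; proj₁; proj₂; uncurry)
open import Data.Sum.Base using (_⊎_; inj₁; inj₂)
open import Data.Vec.Base as Vec using (Vec; []; _∷_; lookup; _[_]≔_; toList; tabulate; here; there)
open import Data.Vec.Membership.Propositional using () renaming (_∈_ to _∈ᵥ_)
import Data.Vec.Membership.DecPropositional as DecVMem
open import Data.Vec.Membership.Propositional.Properties as VMem using (∈-toList⁺)
open import Data.Vec.Properties as Vec using
  ([]=⇒lookup; lookup⇒[]=; lookup∘update; lookup∘update′; []≔-idempotent; []≔-commutes;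
   lookup∘tabulate; tabulate∘lookup; tabulate-cong; ∷-injectiveʳ)
import Data.Vec.Relation.Unary.All as VAll
import Data.Vec.Relation.Unary.All.Properties as VAllP
import Data.Vec.Relation.Unary.Any as VAny
import Data.Vec.Relation.Unary.Any.Properties as VAnyP
open import Function.Base using (_∘_; id)
open import Function.Bundles using (mk⇔; Equivalence)
open import Function.Definitions using (Injective)
open import Relation.Binary.Definitions using (DecidableEquality)
open import Relation.Binary.PropositionalEquality
open import Relation.Nullary using (Dec; yes; no; ¬_; does; contradiction; ¬?; _×-dec_; _→-dec_)
open import Relation.Nullary.Decidable using (dec-true; dec-false)

-- Finite sums

private variable
  I I′ : Set
  Φ Ψ : Set

𝟙 : Dec Φ → ℕ
𝟙 p = if does p then 1 else 0

𝟙≤1 : (p : Dec Φ) → 𝟙 p ≤ 1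
𝟙≤1 (yes _) = ≤-refl
𝟙≤1 (no _)  = z≤n

𝟙-yes : (p : Dec Φ) → Φ → 𝟙 p ≡ 1
𝟙-yes (yes _) _ = refl
𝟙-yes (no ¬p) p = contradiction p ¬p

𝟙-no : (p : Dec Φ) → ¬ Φ → 𝟙 p ≡ 0
𝟙-no (yes p) ¬p = contradiction p ¬p
𝟙-no (no _)  _  = refl

𝟙-mono : (p : Dec Φ) (q : Dec Ψ) → (Φ → Ψ) → 𝟙 p ≤ 𝟙 q
𝟙-mono (no _)  _ _ = z≤n
𝟙-mono (yes p) q f = ≤-reflexive (sym (𝟙-yes q (f p)))

𝟙≡0⇒¬ : (p : Dec Φ) → 𝟙 p ≡ 0 → ¬ Φ
𝟙≡0⇒¬ (no ¬p) _ = ¬p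

∑ : List I → (I → ℕ) → ℕ
∑ xs f = sum (List.map f xs)

∑-cong : {f g : I → ℕ} (xs : List I) → (∀ x → f x ≡ g x) → ∑ xs f ≡ ∑ xs g
∑-cong []       f≡g = refl
∑-cong (x ∷ xs) f≡g = cong₂ _+_ (f≡g x) (∑-cong xs f≡g)

∑-mono : {f g : I → ℕ} (xs : List I) → (∀ x → x ∈ₗ xs → f x ≤ g x) → ∑ xs f ≤ ∑ xs g
∑-mono []       f≤g = z≤n
∑-mono (x ∷ xs) f≤g = +-mono-≤ (f≤g x (here refl)) (∑-mono xs (λ y → f≤g y ∘ there))

∑-zero : (xs : List I) → ∑ xs (λ _ → 0) ≡ 0
∑-zero []       = refl
∑-zero (_ ∷ xs) = ∑-zero xs

∑-+ : (xs : List I) (f g : I → ℕ) → ∑ xs (λ x → f x + g x) ≡ ∑ xs f + ∑ xs g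
∑-+ []       f g = refl
∑-+ (x ∷ xs) f g rewrite ∑-+ xs f g = shuffle (f x) (g x) (∑ xs f) (∑ xs g)
  where
  shuffle : ∀ a b c d → a + b + (c + d) ≡ a + c + (b + d)
  shuffle = solve-∀

∑-*ˡ : (c : ℕ) (xs : List I) (f : I → ℕ) → ∑ xs (λ x → c * f x) ≡ c * ∑ xs f
∑-*ˡ c []       f = sym (*-zeroʳ c)
∑-*ˡ c (x ∷ xs) f rewrite ∑-*ˡ c xs f = sym (*-distribˡ-+ c (f x) (∑ xs f))

∑-*ʳ : (c : ℕ) (xs : List I) (f : I → ℕ) → ∑ xs (λ x → f x * c) ≡ ∑ xs f * c
∑-*ʳ c xs f = begin
  ∑ xs (λ x → f x * c) ≡⟨ ∑-cong xs (λ x → *-comm (f x) c) ⟩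
  ∑ xs (λ x → c * f x) ≡⟨ ∑-*ˡ c xs f ⟩
  c * ∑ xs f           ≡⟨ *-comm c _ ⟩
  ∑ xs f * c           ∎
  where open ≡-Reasoning

∑-const : (xs : List I) (c : ℕ) → ∑ xs (λ _ → c) ≡ length xs * c
∑-const []       c = refl
∑-const (_ ∷ xs) c = cong (c +_) (∑-const xs c)

∑-swap : (xs : List I) (ys : List I′) (f : I → I′ → ℕ) →
         ∑ xs (λ x → ∑ ys (f x)) ≡ ∑ ys (λ y → ∑ xs (λ x → f x y))
∑-swap []       ys f = sym (∑-zero ys)
∑-swap (x ∷ xs) ys f rewrite ∑-swap xs ys f = sym (∑-+ ys (f x) _)

∑-++ : (xs ys : List I) (f : I → ℕ) → ∑ (xs ++ ys) f ≡ ∑ xs f + ∑ ys f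
∑-++ []       ys f = refl
∑-++ (x ∷ xs) ys f rewrite ∑-++ xs ys f = sym (+-assoc (f x) _ _)

∑-map : (h : I → I′) (xs : List I) (f : I′ → ℕ) → ∑ (List.map h xs) f ≡ ∑ xs (f ∘ h)
∑-map h []       f = refl
∑-map h (x ∷ xs) f = cong (f (h x) +_) (∑-map h xs f)

∑-concatMap : (h : I → List I′) (xs : List I) (f : I′ → ℕ) →
              ∑ (concatMap h xs) f ≡ ∑ xs (λ x → ∑ (h x) f)
∑-concatMap h []       f = refl
∑-concatMap h (x ∷ xs) f =
  trans (∑-++ (h x) (concatMap h xs) f) (cong (∑ (h x) f +_) (∑-concatMap h xs f))

∑-filter : {P : I → Set} (P? : ∀ x → Dec (P x)) (xs : List I) →
           length (filter P? xs) ≡ ∑ xs (λ x → 𝟙 (P? x))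
∑-filter P? [] = refl
∑-filter P? (x ∷ xs) with does (P? x)
... | true  = cong suc (∑-filter P? xs)
... | false = ∑-filter P? xs

∑-∈ : {xs : List I} {x : I} (f : I → ℕ) → x ∈ₗ xs → f x ≤ ∑ xs f
∑-∈ f (here refl) = m≤m+n _ _
∑-∈ f (there x∈)  = ≤-trans (∑-∈ f x∈) (m≤n+m _ _)

∑-<⇒∃ : (xs : List I) {f g : I → ℕ} → ∑ xs f < ∑ xs g → ∃ λ x → f x < g x
∑-<⇒∃ (x ∷ xs) {f} {g} lt with f x <? g x
... | yes p = x , p
... | no ¬p = ∑-<⇒∃ xs (≰⇒> λ h → <⇒≱ lt (+-mono-≤ (≮⇒≥ ¬p) h))

∑-𝟙-unique : (_≟_ : DecidableEquality I) (a : I) {xs : List I} → Unique xs →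
             ∑ xs (λ x → 𝟙 (a ≟ x)) ≤ 𝟙 (any? (a ≟_) xs)
∑-𝟙-unique _≟_ a []         = z≤n
∑-𝟙-unique _≟_ a {x ∷ xs} (x∉ ∷ u) with a ≟ x
... | no a≢x   = ≤-trans (∑-𝟙-unique _≟_ a u) (𝟙-mono (any? (a ≟_) xs) (any? (a ≟_) xs) id)
... | yes refl = ≤-reflexive (cong suc (n≤0⇒n≡0 (≤-trans (∑-𝟙-unique _≟_ a u)
                   (≤-reflexive (𝟙-no (any? (a ≟_) xs) (λ a∈ → All.lookup x∉ a∈ refl))))))

-- Count the pairs of an `x` in `xs` and an equal `c` in `cs` in two ways: every `x` meets some `c`;
-- as `xs` has no repetitions, every `c` meets at most one `x`, and if it does then `P c` holds.
length≤∑𝟙 : (_≟_ : DecidableEquality I) {P : I → Set} (P? : ∀ x → Dec (P x))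
            {xs cs : List I} → Unique xs → (∀ {x} → x ∈ₗ xs → x ∈ₗ cs × P x) →
            length xs ≤ ∑ cs (λ c → 𝟙 (P? c))
length≤∑𝟙 _≟_ P? {xs} {cs} u sub = begin
  length xs                                 ≡⟨ *-identityʳ _ ⟨
  length xs * 1                             ≡⟨ ∑-const xs 1 ⟨
  ∑ xs (λ _ → 1)                            ≤⟨ ∑-mono xs (λ x x∈ → hit x (sub x∈ .proj₁)) ⟩
  ∑ xs (λ x → ∑ cs (λ c → 𝟙 (c ≟ x)))       ≡⟨ ∑-swap xs cs _ ⟩
  ∑ cs (λ c → ∑ xs (λ x → 𝟙 (c ≟ x)))       ≤⟨ ∑-mono cs (λ c _ → ≤-trans (∑-𝟙-unique _≟_ c u)
                                                 (𝟙-mono (any? (c ≟_) xs) (P? c) (λ c∈ → sub c∈ .proj₂))) ⟩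
  ∑ cs (λ c → 𝟙 (P? c))                     ∎
  where
  open ≤-Reasoning
  hit : ∀ x → x ∈ₗ cs → 1 ≤ ∑ cs (λ c → 𝟙 (c ≟ x))
  hit x x∈ = ≤-trans (≤-reflexive (sym (𝟙-yes (x ≟ x) refl))) (∑-∈ (λ c → 𝟙 (c ≟ x)) x∈)

∑𝟙≤length : (_≟_ : DecidableEquality I) {P : I → Set} (P? : ∀ x → Dec (P x))
            {xs cs : List I} → Unique cs → (∀ {c} → P c → c ∈ₗ xs) →
            ∑ cs (λ c → 𝟙 (P? c)) ≤ length xs
∑𝟙≤length _≟_ P? {xs} {cs} u sub = begin
  ∑ cs (λ c → 𝟙 (P? c))                  ≤⟨ ∑-mono cs (λ c _ → hit c (P? c)) ⟩
  ∑ cs (λ c → ∑ xs (λ x → 𝟙 (x ≟ c)))    ≡⟨ ∑-swap cs xs _ ⟩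
  ∑ xs (λ x → ∑ cs (λ c → 𝟙 (x ≟ c)))    ≤⟨ ∑-mono xs (λ x _ → ≤-trans (∑-𝟙-unique _≟_ x u) (𝟙≤1 (any? (x ≟_) cs))) ⟩
  ∑ xs (λ _ → 1)                         ≡⟨ ∑-const xs 1 ⟩
  length xs * 1                          ≡⟨ *-identityʳ _ ⟩
  length xs                              ∎
  where
  open ≤-Reasoning
  hit : ∀ c (p : Dec _) → 𝟙 p ≤ ∑ xs (λ x → 𝟙 (x ≟ c))
  hit c (no _)  = z≤n
  hit c (yes p) = ≤-trans (≤-reflexive (sym (𝟙-yes (c ≟ c) refl))) (∑-∈ (λ x → 𝟙 (x ≟ c)) (sub p))

-- Sums over tuples

tuples : List I → (t : ℕ) → List (Vec I t)
tuples xs zero    = [] ∷ []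
tuples xs (suc t) = concatMap (λ x → List.map (x ∷_) (tuples xs t)) xs

∑-tuples : (xs : List I) (t : ℕ) (f : Vec I (suc t) → ℕ) →
           ∑ (tuples xs (suc t)) f ≡ ∑ xs (λ x → ∑ (tuples xs t) (λ v → f (x ∷ v)))
∑-tuples xs t f = trans (∑-concatMap _ xs f) (∑-cong xs (λ x → ∑-map (x ∷_) (tuples xs t) f))

length-tuples : (xs : List I) (t : ℕ) → length (tuples xs t) ≡ length xs ^ t
length-tuples xs t = trans (sym (trans (∑-const (tuples xs t) 1) (*-identityʳ _))) (count t)
  where
  open ≡-Reasoning
  count : ∀ t → ∑ (tuples xs t) (λ _ → 1) ≡ length xs ^ t
  count zero    = refl
  count (suc t) = begin
    ∑ (tuples xs (suc t)) (λ _ → 1)             ≡⟨ ∑-tuples xs t _ ⟩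
    ∑ xs (λ _ → ∑ (tuples xs t) (λ _ → 1))      ≡⟨ ∑-const xs _ ⟩
    length xs * ∑ (tuples xs t) (λ _ → 1)       ≡⟨ cong (length xs *_) (count t) ⟩
    length xs * length xs ^ t                   ∎

∈-tuples : {xs : List I} {t : ℕ} (v : Vec I t) → (∀ i → lookup v i ∈ₗ xs) → v ∈ₗ tuples xs t
∈-tuples []      _  = here refl
∈-tuples {xs = xs} (x ∷ v) h = ∈-concatMap⁺ _ {xs = xs}
  (Any.map (λ {refl → ∈-map⁺ (x ∷_) (∈-tuples v (h ∘ suc))}) (h zero))

-- The indicator of `All` is a product over the entries, so the sum factorises: the entries of a
-- sample are independent.
∑-tuples-all : {W : I → Set} (W? : ∀ x → Dec (W x)) (xs : List I) (t : ℕ) →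
               ∑ (tuples xs t) (λ T → 𝟙 (VAll.all? W? T)) ≡ ∑ xs (λ x → 𝟙 (W? x)) ^ t
∑-tuples-all W? xs zero    = refl
∑-tuples-all W? xs (suc t) = begin
  ∑ (tuples xs (suc t)) (λ T → 𝟙 (VAll.all? W? T))                       ≡⟨ ∑-tuples xs t _ ⟩
  ∑ xs (λ x → ∑ (tuples xs t) (λ T → 𝟙 (VAll.all? W? (x ∷ T))))          ≡⟨ ∑-cong xs (λ x → trans
                                                                              (∑-cong (tuples xs t) (head x))
                                                                              (∑-*ˡ (𝟙 (W? x)) (tuples xs t) _)) ⟩
  ∑ xs (λ x → 𝟙 (W? x) * ∑ (tuples xs t) (λ T → 𝟙 (VAll.all? W? T)))     ≡⟨ ∑-*ʳ _ xs _ ⟩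
  ∑ xs (λ x → 𝟙 (W? x)) * ∑ (tuples xs t) (λ T → 𝟙 (VAll.all? W? T))     ≡⟨ cong (∑ xs (λ x → 𝟙 (W? x)) *_) (∑-tuples-all W? xs t) ⟩
  ∑ xs (λ x → 𝟙 (W? x)) * ∑ xs (λ x → 𝟙 (W? x)) ^ t                      ∎
  where
  open ≡-Reasoning
  head : ∀ x T → 𝟙 (VAll.all? W? (x ∷ T)) ≡ 𝟙 (W? x) * 𝟙 (VAll.all? W? T)
  head x T with does (W? x)
  ... | true  = sym (*-identityˡ _)
  ... | false = refl

-- The entry at `i` is overwritten, so every updated tuple arises once for each old value of that
-- entry.
∑-resample : (xs : List I) (k : ℕ) (i : Fin k) (f : Vec I k → ℕ) →
             ∑ (tuples xs k) (λ v → ∑ xs (λ y → f (v [ i ]≔ y))) ≡ length xs * ∑ (tuples xs k) f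
∑-resample xs (suc k) zero f = begin
  ∑ (tuples xs (suc k)) (λ v → ∑ xs (λ y → f (v [ zero ]≔ y)))      ≡⟨ ∑-tuples xs k _ ⟩
  ∑ xs (λ _ → ∑ (tuples xs k) (λ v → ∑ xs (λ y → f (y ∷ v))))       ≡⟨ ∑-const xs _ ⟩
  length xs * ∑ (tuples xs k) (λ v → ∑ xs (λ y → f (y ∷ v)))        ≡⟨ cong (length xs *_) (∑-swap (tuples xs k) xs _) ⟩
  length xs * ∑ xs (λ y → ∑ (tuples xs k) (λ v → f (y ∷ v)))        ≡⟨ cong (length xs *_) (∑-tuples xs k f) ⟨
  length xs * ∑ (tuples xs (suc k)) f                               ∎
  where open ≡-Reasoning
∑-resample xs (suc k) (suc i) f = begin
  ∑ (tuples xs (suc k)) (λ v → ∑ xs (λ y → f (v [ suc i ]≔ y)))                ≡⟨ ∑-tuples xs k _ ⟩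
  ∑ xs (λ x → ∑ (tuples xs k) (λ v → ∑ xs (λ y → f (x ∷ (v [ i ]≔ y)))))       ≡⟨ ∑-cong xs (λ x → ∑-resample xs k i (f ∘ (x ∷_))) ⟩
  ∑ xs (λ x → length xs * ∑ (tuples xs k) (λ v → f (x ∷ v)))                   ≡⟨ ∑-*ˡ (length xs) xs _ ⟩
  length xs * ∑ xs (λ x → ∑ (tuples xs k) (λ v → f (x ∷ v)))                   ≡⟨ cong (length xs *_) (∑-tuples xs k f) ⟨
  length xs * ∑ (tuples xs (suc k)) f                                          ∎
  where open ≡-Reasoning

-- Inequalities for power sums

rearrangement : ∀ {a b c d} → a ≤ b → c ≤ d → a * d + b * c ≤ a * c + b * d
-- With `b = a + u` and `d = c + v` the two sides differ by `u * v`, and no truncated subtraction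
-- remains.
rearrangement {a} {b} {c} {d} a≤b c≤d = subst₂ (λ b d → a * d + b * c ≤ a * c + b * d)
  (m+[n∸m]≡n a≤b) (m+[n∸m]≡n c≤d) (begin
  a * (c + v) + (a + u) * c             ≤⟨ m≤m+n _ (u * v) ⟩
  a * (c + v) + (a + u) * c + u * v     ≡⟨ expand a c u v ⟩
  a * c + (a + u) * (c + v)             ∎)
  where
  open ≤-Reasoning
  u = b ∸ a
  v = d ∸ c
  expand : ∀ a c u v → a * (c + v) + (a + u) * c + u * v ≡ a * c + (a + u) * (c + v)
  expand = solve-∀

-- Chebyshev's sum inequality for the similarly ordered functions `f` and `f ^ s`: after doubling,
-- it is a sum over all pairs `(x , y)` of instances of the rearrangement inequality.
chebyshev : (xs : List I) (f : I → ℕ) (s : ℕ) →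
            ∑ xs f * ∑ xs (λ x → f x ^ s) ≤ length xs * ∑ xs (λ x → f x * f x ^ s)
chebyshev xs f s = *-cancelˡ-≤ 2 (begin
  2 * (F * G)                                                        ≡⟨ double (F * G) ⟩
  F * G + F * G                                                      ≡⟨ cong₂ _+_ fg gf ⟩
  ∑∑ (λ x y → f x * g y) + ∑∑ (λ x y → f y * g x)                    ≡⟨ ∑∑-+ _ _ ⟨
  ∑∑ (λ x y → f x * g y + f y * g x)                                 ≤⟨ ∑-mono xs (λ x _ → ∑-mono xs (λ y _ → swap x y)) ⟩
  ∑∑ (λ x y → f x * g x + f y * g y)                                 ≡⟨ ∑∑-+ _ _ ⟩
  ∑∑ (λ x y → f x * g x) + ∑∑ (λ x y → f y * g y)                    ≡⟨ cong₂ _+_ xx (∑-const xs _) ⟩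
  length xs * H + length xs * H                                      ≡⟨ double (length xs * H) ⟨
  2 * (length xs * H)                                                ∎)
  where
  open ≤-Reasoning
  g = λ x → f x ^ s
  F = ∑ xs f
  G = ∑ xs g
  H = ∑ xs (λ x → f x * g x)
  ∑∑ : (_ → _ → ℕ) → ℕ
  ∑∑ h = ∑ xs (λ x → ∑ xs (h x))
  ∑∑-+ : ∀ h h′ → ∑∑ (λ x y → h x y + h′ x y) ≡ ∑∑ h + ∑∑ h′
  ∑∑-+ h h′ = trans (∑-cong xs (λ x → ∑-+ xs (h x) (h′ x))) (∑-+ xs _ _)
  double : ∀ a → 2 * a ≡ a + a
  double = solve-∀
  fg : F * G ≡ ∑∑ (λ x y → f x * g y)
  fg = sym (trans (∑-cong xs (λ x → ∑-*ˡ (f x) xs g)) (∑-*ʳ G xs f))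
  gf : F * G ≡ ∑∑ (λ x y → f y * g x)
  gf = trans fg (∑-swap xs xs _)
  xx : ∑∑ (λ x y → f x * g x) ≡ length xs * H
  xx = trans (∑-cong xs (λ x → ∑-const xs _)) (∑-*ˡ (length xs) xs _)
  swap : ∀ x y → f x * g y + f y * g x ≤ f x * g x + f y * g y
  swap x y with ≤-total (f x) (f y)
  ... | inj₁ le = rearrangement le (^-monoˡ-≤ s le)
  ... | inj₂ ge = subst₂ _≤_ (+-comm (f y * g x) (f x * g y)) (+-comm (f y * g y) (f x * g x))
                    (rearrangement ge (^-monoˡ-≤ s ge))

-- Jensen's inequality cleared of denominators; each further power costs one application of
-- Chebyshev's inequality.
power-mean : (xs : List I) (f : I → ℕ) (s : ℕ) →
             ∑ xs f ^ suc s ≤ length xs ^ s * ∑ xs (λ x → f x ^ suc s)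
power-mean xs f zero    = ≤-reflexive (trans (*-identityʳ _)
  (sym (trans (*-identityˡ _) (∑-cong xs (λ x → *-identityʳ (f x))))))
power-mean xs f (suc s) = begin
  F * F ^ suc s                                       ≤⟨ *-monoʳ-≤ F (power-mean xs f s) ⟩
  F * (L ^ s * ∑ xs (λ x → f x ^ suc s))              ≡⟨ x∙yz F (L ^ s) _ ⟩
  L ^ s * (F * ∑ xs (λ x → f x ^ suc s))              ≤⟨ *-monoʳ-≤ (L ^ s) (chebyshev xs f (suc s)) ⟩
  L ^ s * (L * ∑ xs (λ x → f x ^ suc (suc s)))        ≡⟨ xy∙z (L ^ s) L _ ⟩
  L * L ^ s * ∑ xs (λ x → f x ^ suc (suc s))          ∎
  where
  open ≤-Reasoning
  F = ∑ xs f
  L = length xs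
  x∙yz : ∀ a b c → a * (b * c) ≡ b * (a * c)
  x∙yz = solve-∀
  xy∙z : ∀ a b c → a * (b * c) ≡ b * a * c
  xy∙z = solve-∀

-- Sublists, integer roots and powers

sublists : List I → List (List I)
sublists []       = [] ∷ []
sublists (x ∷ xs) = sublists xs ++ List.map (x ∷_) (sublists xs)

length-sublists : (xs : List I) → length (sublists xs) ≡ 2 ^ length xs
length-sublists []       = refl
length-sublists (x ∷ xs) = begin
  length (sublists xs ++ List.map (x ∷_) (sublists xs))       ≡⟨ length-++ (sublists xs) ⟩
  length (sublists xs) + length (List.map (x ∷_) (sublists xs)) ≡⟨ cong (length (sublists xs) +_) (length-map (x ∷_) (sublists xs)) ⟩
  length (sublists xs) + length (sublists xs)                 ≡⟨ cong₂ _+_ (length-sublists xs) (trans (length-sublists xs) (sym (+-identityʳ _))) ⟩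
  2 * 2 ^ length xs                                           ∎
  where open ≡-Reasoning

filter∈sublists : {P : I → Set} (P? : ∀ x → Dec (P x)) (xs : List I) → filter P? xs ∈ₗ sublists xs
filter∈sublists P? [] = here refl
filter∈sublists P? (x ∷ xs) with does (P? x)
... | true  = ∈-++⁺ʳ (sublists xs) (∈-map⁺ (x ∷_) (filter∈sublists P? xs))
... | false = ∈-++⁺ˡ (filter∈sublists P? xs)

-- The floor of the `Q`-th root, by induction on `n`: passing to `suc n` raises it by at most one.
root : (Q : ℕ) → 1 ≤ Q → (n : ℕ) → ∃ λ z → z ^ Q ≤ n × n < suc z ^ Q
root Q@(suc _) _ zero    = 0 , z≤n , m^n>0 1 Q
root Q 1≤Q (suc n) with root Q 1≤Q n
... | z , z^Q≤n , n<sz^Q with suc z ^ Q ≤? suc n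
...   | no h  = z , ≤-trans z^Q≤n (n≤1+n n) , ≰⇒> h
...   | yes h = suc z , h , <-≤-trans (s≤s n<sz^Q) (^-monoˡ-< Q {{>-nonZero 1≤Q}} (n<1+n (suc z)))

^-distribʳ-* : ∀ m n o → (m * n) ^ o ≡ m ^ o * n ^ o
^-distribʳ-* m n zero    = refl
^-distribʳ-* m n (suc o) rewrite ^-distribʳ-* m n o = shuffle m n (m ^ o) (n ^ o)
  where
  shuffle : ∀ a b c d → a * b * (c * d) ≡ a * c * (b * d)
  shuffle = solve-∀

^-cancelʳ-≤ : ∀ {a b} n → a ^ suc n ≤ b ^ suc n → a ≤ b
^-cancelʳ-≤ n h = ≮⇒≥ λ b<a → <⇒≱ (^-monoˡ-< (suc n) b<a) h

-- Hypergraph dependent random choice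

large⇒avoiding : ∀ {n} {W : Fin n → Set} (W? : ∀ w → Dec (W w)) (avoid : List (Fin n)) →
                 length avoid < ∑ (allFin n) (λ w → 𝟙 (W? w)) → ∃ λ w → W w × w ∉ₗ avoid
large⇒avoiding {n} W? avoid lt
  with any? (λ w → W? w ×-dec ¬? (w ∈? avoid)) (allFin n)
  where open DecMem (Fin._≟_ {n})
... | yes p = satisfied p
... | no ¬p = contradiction lt (≤⇒≯ (∑𝟙≤length Fin._≟_ W? (Uniq.allFin⁺ n) W⊆avoid))
  where
  open DecMem (Fin._≟_ {n})
  W⊆avoid : ∀ {w} → _ → w ∈ₗ avoid
  W⊆avoid {w} Ww with w ∈? avoid
  ... | yes w∈ = w∈
  ... | no w∉  = contradiction (loseₗ (∈-allFin w) (Ww , w∉)) ¬p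

-- Unlike 4 ^ l * D, the successor case unfolds to D′ + 3 * D′ with D′ = 4^[ l ]* D, as expands-restrict needs.
4^[_]*_ : ℕ → ℕ → ℕ
4^[ zero  ]* D = D
4^[ suc l ]* D = 4 * (4^[ l ]* D)

infix 7 4^[_]*_

module _ {k n : ℕ} where

  -- A single `w` serves all tuples over `N` at once. The embedding relies on this, since moving one
  -- vertex of `H` changes every edge through it.
  Expands : Fin k → ℕ → ℕ → (Vec (Fin n) k → Set) → Set
  Expands i D M E =
    ∀ (N : Vec (Fin n) D) (avoid : List (Fin n)) → length avoid < M →
    ∃ λ w → w ∉ₗ avoid ×
      (∀ x → E x → (∀ j → j ≢ i → lookup x j ∈ᵥ N) → E (x [ i ]≔ w))

  Restrict : ∀ {t} → Fin k → Vec (Fin n) t → (Vec (Fin n) k → Set) → Vec (Fin n) k → Set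
  Restrict i T E x = E x × VAll.All (λ y → E (x [ i ]≔ y)) T

  restrict? : ∀ {t E} (i : Fin k) (T : Vec (Fin n) t) → (∀ x → Dec (E x)) → ∀ x → Dec (Restrict i T E x)
  restrict? i T E? x = E? x ×-dec VAll.all? (λ y → E? (x [ i ]≔ y)) T

  size : {E : Vec (Fin n) k → Set} → (∀ x → Dec (E x)) → ℕ
  size E? = ∑ (tuples (allFin n) k) (λ x → 𝟙 (E? x))

  length-allFin : length (allFin n) ≡ n
  length-allFin = length-tabulate id

  size≤ : {E : Vec (Fin n) k → Set} (E? : ∀ x → Dec (E x)) → size E? ≤ n ^ k
  size≤ E? = begin
    size E?                                       ≤⟨ ∑-mono (tuples (allFin n) k) (λ x _ → 𝟙≤1 (E? x)) ⟩
    ∑ (tuples (allFin n) k) (λ _ → 1)             ≡⟨ ∑-const (tuples (allFin n) k) 1 ⟩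
    length (tuples (allFin n) k) * 1              ≡⟨ *-identityʳ _ ⟩
    length (tuples (allFin n) k)                  ≡⟨ length-tuples (allFin n) k ⟩
    length (allFin n) ^ k                         ≡⟨ cong (_^ k) length-allFin ⟩
    n ^ k                                         ∎
    where open ≤-Reasoning

  -- For `x` in the restriction, `x` and all `x [ i′ ]≔ y` with `y` in `T` lie in `E` and have their
  -- entries off `i` in `N Vec.++ T`. One `w` therefore extends them all, and updates at distinct
  -- coordinates commute.
  expands-restrict : ∀ {i i′ D t M E} (T : Vec (Fin n) t) → i ≢ i′ →
                     Expands i (D + t) M E → Expands i D M (Restrict i′ T E)
  expands-restrict {i} {i′} {E = E} T i≢i′ ex N avoid small with ex (N Vec.++ T) avoid small
  ... | w , w∉ , ext = w , w∉ , λ x (Ex , ExT) x∈N →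
    ext x Ex (λ j j≢i → VMem.∈-++⁺ˡ (x∈N j j≢i)) ,
    VAllP.lookup⁻ (λ a → subst E ([]≔-commutes x i′ i (i≢i′ ∘ sym))
      (ext (x [ i′ ]≔ lookup T a) (VAllP.lookup⁺ ExT a) (λ j j≢i → moved x x∈N (lookup T a) (VMem.∈-lookup a T) j j≢i)))
    where
    moved : ∀ x → (∀ j → j ≢ i → lookup x j ∈ᵥ N) → ∀ y → y ∈ᵥ T →
            ∀ j → j ≢ i → lookup (x [ i′ ]≔ y) j ∈ᵥ (N Vec.++ T)
    moved x x∈N y y∈T j j≢i with j Fin.≟ i′
    ... | yes refl = subst (_∈ᵥ _) (sym (lookup∘update j x y)) (VMem.∈-++⁺ʳ N y∈T)
    ... | no j≢i′  = subst (_∈ᵥ _) (sym (lookup∘update′ j≢i′ x y)) (VMem.∈-++⁺ˡ (x∈N j j≢i))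

  module Sampling (o : Fin n) (i : Fin k) {E : Vec (Fin n) k → Set} (E? : ∀ x → Dec (E x)) where

    private
      V = allFin n
      Vᵏ = tuples V k

      |V| : length V ≡ n
      |V| = length-allFin

      |Vᵏ| : length Vᵏ ≡ n ^ k
      |Vᵏ| = trans (length-tuples V k) (cong (_^ k) |V|)

      instance
        n≢0 : NonZero n
        n≢0 = Fin.nonZeroIndex o

    -- A tuple `x` of `E` survives for exactly `deg x ^ t` samples. As `deg x` does not depend on
    -- the entry at `i`, resampling that entry turns the total into a sum of `deg x ^ suc t`, to
    -- which the power mean inequality applies.
    ∑-size-restrict : ∀ t → n ^ t * size E? ^ suc t ≤ (n ^ k) ^ t * ∑ (tuples V t) (λ T → size (restrict? i T E?))
    ∑-size-restrict t = *-cancelˡ-≤ n (begin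
      n * (n ^ t * size E? ^ suc t)          ≡⟨ *-assoc n (n ^ t) _ ⟨
      n ^ suc t * size E? ^ suc t            ≡⟨ ^-distribʳ-* n (size E?) (suc t) ⟨
      (n * size E?) ^ suc t                  ≡⟨ cong (_^ suc t) ∑-deg ⟨
      ∑ Vᵏ deg ^ suc t                       ≤⟨ power-mean Vᵏ deg t ⟩
      length Vᵏ ^ t * ∑ Vᵏ (λ x → deg x ^ suc t)    ≡⟨ cong₂ (λ a b → a ^ t * b) |Vᵏ| (sym ∑-deg^) ⟩
      (n ^ k) ^ t * (n * S)                  ≡⟨ swap ((n ^ k) ^ t) n S ⟩
      n * ((n ^ k) ^ t * S)                  ∎)
      where
      open ≤-Reasoning
      S = ∑ (tuples V t) (λ T → size (restrict? i T E?))
      deg : Vec (Fin n) k → ℕ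
      deg x = ∑ V (λ y → 𝟙 (E? (x [ i ]≔ y)))
      ∑-deg : ∑ Vᵏ deg ≡ n * size E?
      ∑-deg = trans (∑-resample V k i (𝟙 ∘ E?)) (cong (_* size E?) |V|)
      swap : ∀ a b c → a * (b * c) ≡ b * (a * c)
      swap = solve-∀
      𝟙-× : ∀ {P Q : Set} (p : Dec P) (q : Dec Q) → 𝟙 (p ×-dec q) ≡ 𝟙 p * 𝟙 q
      𝟙-× (yes _) q = sym (+-identityʳ _)
      𝟙-× (no _)  q = refl
      S≡ : S ≡ ∑ Vᵏ (λ x → 𝟙 (E? x) * deg x ^ t)
      S≡ = trans (∑-swap (tuples V t) Vᵏ _) (∑-cong Vᵏ λ x →
           trans (∑-cong (tuples V t) (λ T → 𝟙-× (E? x) (VAll.all? (λ y → E? (x [ i ]≔ y)) T)))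
           (trans (∑-*ˡ (𝟙 (E? x)) (tuples V t) _)
           (cong (𝟙 (E? x) *_) (∑-tuples-all (λ y → E? (x [ i ]≔ y)) V t))))
      deg-update : ∀ x y → deg (x [ i ]≔ y) ≡ deg x
      deg-update x y = ∑-cong V (λ y′ → cong (𝟙 ∘ E?) ([]≔-idempotent x i))
      ∑-deg^ : n * S ≡ ∑ Vᵏ (λ x → deg x ^ suc t)
      ∑-deg^ = trans (cong₂ _*_ (sym |V|) S≡)
        (trans (sym (∑-resample V k i (λ x → 𝟙 (E? x) * deg x ^ t)))
        (∑-cong Vᵏ λ x → trans (∑-cong V λ y → cong (λ e → 𝟙 (E? (x [ i ]≔ y)) * e ^ t) (deg-update x y))
                               (∑-*ʳ (deg x ^ t) V _)))

    Common : List (Vec (Fin n) k) → Fin n → Set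
    Common F w = All (λ x → E (x [ i ]≔ w)) F

    common? : ∀ F w → Dec (Common F w)
    common? F w = All.all? (λ x → E? (x [ i ]≔ w)) F

    -- `Common` overwrites the entry at `i`, so the placeholder `o` can stand there. All families
    -- over `N` then use only `suc D` letters, which bounds their number independently of `n`.
    patterns : ∀ {D} → Vec (Fin n) D → List (List (Vec (Fin n) k))
    patterns N = sublists (tuples (o ∷ toList N) k)

    -- Every sparse pattern whose common neighbourhood contains the sample T is charged 1.
    penalty : ∀ {t} → ℕ → ℕ → Vec (Fin n) t → ℕ
    penalty D M T = ∑ (tuples V D) λ N → ∑ (patterns N) λ F →
      𝟙 (∑ V (λ w → 𝟙 (common? F w)) <? M) * 𝟙 (VAll.all? (common? F) T)

    -- A union bound: there are `n ^ D` choices of `N`, at most `2 ^ (suc D ^ k)` families over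
    -- each, and a family with fewer than `M` common completions contains at most `M ^ t` samples
    -- among them.
    ∑-penalty : ∀ D M t → ∑ (tuples V t) (penalty D M) ≤ n ^ D * (2 ^ (suc D ^ k) * M ^ t)
    ∑-penalty D M t = begin
      ∑ Vᵗ (penalty D M)
        ≡⟨ ∑-swap Vᵗ (tuples V D) _ ⟩
      ∑ (tuples V D) (λ N → ∑ Vᵗ λ T → ∑ (patterns N) λ F → sparse F * hit F T)
        ≤⟨ ∑-mono (tuples V D) (λ N _ → per-N N) ⟩
      ∑ (tuples V D) (λ N → 2 ^ (suc D ^ k) * M ^ t)
        ≡⟨ ∑-const (tuples V D) _ ⟩
      length (tuples V D) * (2 ^ (suc D ^ k) * M ^ t)
        ≡⟨ cong (_* (2 ^ (suc D ^ k) * M ^ t)) (trans (length-tuples V D) (cong (_^ D) |V|)) ⟩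
      n ^ D * (2 ^ (suc D ^ k) * M ^ t) ∎
      where
      open ≤-Reasoning
      Vᵗ = tuples V t
      |W| : List (Vec (Fin n) k) → ℕ
      |W| F = ∑ V (λ w → 𝟙 (common? F w))
      sparse : List (Vec (Fin n) k) → ℕ
      sparse F = 𝟙 (|W| F <? M)
      hit : List (Vec (Fin n) k) → Vec (Fin n) t → ℕ
      hit F T = 𝟙 (VAll.all? (common? F) T)
      few : ∀ F → (s : Dec (|W| F < M)) → 𝟙 s * |W| F ^ t ≤ M ^ t
      few F (yes lt) = ≤-trans (≤-reflexive (+-identityʳ _)) (^-monoˡ-≤ t (<⇒≤ lt))
      few F (no _)   = z≤n
      per-F : ∀ F → ∑ Vᵗ (λ T → sparse F * hit F T) ≤ M ^ t
      per-F F = ≤-trans (≤-reflexive (trans (∑-*ˡ (sparse F) Vᵗ _) (cong (sparse F *_) (∑-tuples-all (common? F) V t))))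
                        (few F (|W| F <? M))
      |patterns| : ∀ N → length (patterns {D} N) ≡ 2 ^ (suc D ^ k)
      |patterns| N = trans (length-sublists (tuples (o ∷ toList N) k)) (cong (2 ^_)
        (trans (length-tuples (o ∷ toList N) k) (cong (λ l → suc l ^ k) (Vec.length-toList N))))
      per-N : ∀ N → ∑ Vᵗ (λ T → ∑ (patterns N) λ F → sparse F * hit F T) ≤ 2 ^ (suc D ^ k) * M ^ t
      per-N N = begin
        ∑ Vᵗ (λ T → ∑ (patterns N) λ F → sparse F * hit F T)   ≡⟨ ∑-swap Vᵗ (patterns N) _ ⟩
        ∑ (patterns N) (λ F → ∑ Vᵗ λ T → sparse F * hit F T)   ≤⟨ ∑-mono (patterns N) (λ F _ → per-F F) ⟩
        ∑ (patterns N) (λ _ → M ^ t)                           ≡⟨ ∑-const (patterns N) _ ⟩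
        length (patterns N) * M ^ t                            ≡⟨ cong (_* M ^ t) (|patterns| N) ⟩
        2 ^ (suc D ^ k) * M ^ t                                ∎

    -- Let `F` consist of all patterns over `N` that every vertex of `T` completes. Its common
    -- completions contain `T`, so zero penalty means that there are at least `M` of them, and one
    -- lies outside `avoid`. Every tuple of the restriction over `N` has its pattern in `F`.
    unpenalised⇒expands : ∀ {t} D M (T : Vec (Fin n) t) → penalty D M T ≡ 0 → Expands i D M (Restrict i T E)
    unpenalised⇒expands D M T pen≡0 N avoid small
      with large⇒avoiding (common? F) avoid (<-≤-trans small M≤|W|)
      where
      F = filter (λ x → VAll.all? (λ y → E? (x [ i ]≔ y)) T) (tuples (o ∷ toList N) k)
      T⊆W : VAll.All (Common F) T
      T⊆W = VAllP.lookup⁻ λ a → All.tabulate λ {x} x∈F →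
        VAllP.lookup⁺ (∈-filter⁻ (λ x → VAll.all? (λ y → E? (x [ i ]≔ y)) T) {xs = tuples (o ∷ toList N) k} x∈F .proj₂) a
      term : ℕ
      term = 𝟙 (∑ V (λ w → 𝟙 (common? F w)) <? M) * 𝟙 (VAll.all? (common? F) T)
      term≡0 : term ≡ 0
      term≡0 = n≤0⇒n≡0 (≤-trans (≤-trans
        (∑-∈ {xs = patterns N} (λ F → 𝟙 (∑ V (λ w → 𝟙 (common? F w)) <? M) * 𝟙 (VAll.all? (common? F) T))
          (filter∈sublists _ (tuples (o ∷ toList N) k)))
        (∑-∈ {xs = tuples V D} (λ N → ∑ (patterns N) λ F → 𝟙 (∑ V (λ w → 𝟙 (common? F w)) <? M) * 𝟙 (VAll.all? (common? F) T))
          (∈-tuples N (λ a → ∈-allFin (lookup N a)))))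
        (≤-reflexive pen≡0))
      M≤|W| : M ≤ ∑ V (λ w → 𝟙 (common? F w))
      M≤|W| = ≮⇒≥ (𝟙≡0⇒¬ (∑ V (λ w → 𝟙 (common? F w)) <? M)
        (trans (sym (*-identityʳ _)) (trans (cong (𝟙 (∑ V (λ w → 𝟙 (common? F w)) <? M) *_) (sym (𝟙-yes (VAll.all? (common? F) T) T⊆W))) term≡0)))
    ... | w , Ww , w∉ = w , w∉ , λ x (Ex , ExT) x∈N →
      subst E ([]≔-idempotent x i) (All.lookup Ww (∈-filter⁺ (λ x → VAll.all? (λ y → E? (x [ i ]≔ y)) T)
        (∈-tuples (x [ i ]≔ o) (pattern∈ x x∈N)) (VAll.map (subst E (sym ([]≔-idempotent x i))) ExT))) ,
      VAll.map (subst E (sym ([]≔-idempotent x i))) ExT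
      where
      pattern∈ : ∀ x → (∀ j → j ≢ i → lookup x j ∈ᵥ N) → ∀ j → lookup (x [ i ]≔ o) j ∈ₗ o ∷ toList N
      pattern∈ x x∈N j with j Fin.≟ i
      ... | yes refl = here (lookup∘update i x o)
      ... | no j≢i   = there (subst (_∈ₗ toList N) (sym (lookup∘update′ j≢i x o)) (∈-toList⁺ (x∈N j j≢i)))

    -- First moment: summed over all `T`, `size * Z` exceeds `X + penalty * (X * Z)`, so some `T`
    -- satisfies this inequality. Since no size exceeds `X`, its penalty is zero, and what remains
    -- is the density bound.
    sample : ∀ {t} D M z b → 2 ≤ z → n ^ k ≤ size E? * z ^ b →
             n ^ D * (2 ^ (suc D ^ k) * M ^ t) * z ^ suc (b * suc t) < n ^ t →
             ∃ λ (T : Vec (Fin n) t) → Expands i D M (Restrict i T E) ×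
               n ^ k ≤ size (restrict? i T E?) * z ^ suc (b * suc t)
    sample {t} D M z b 2≤z dense room with ∑-<⇒∃ (tuples V t) average
      where
      open ≤-Reasoning
      X = n ^ k
      Z = z ^ suc (b * suc t)
      S = ∑ (tuples V t) (λ T → size (restrict? i T E?))
      C = ∑ (tuples V t) (penalty D M)
      instance
        X≢0 : NonZero X
        X≢0 = m^n≢0 n k
        X^t≢0 : NonZero (X ^ t)
        X^t≢0 = m^n≢0 X t
      CZ<n^t : C * Z < n ^ t
      CZ<n^t = ≤-<-trans (*-monoˡ-≤ Z (∑-penalty D M t)) room
      -- The `suc` in the exponent of `Z` supplies a factor `z ≥ 2`, which pays for the 2: one half
      -- of the total covers `X`, the other the penalties.
      total : 2 * n ^ t * X ≤ S * Z
      total = *-cancelˡ-≤ (X ^ t) (begin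
        X ^ t * (2 * n ^ t * X)                           ≡⟨ e₁ (X ^ t) (n ^ t) X ⟩
        n ^ t * (X ^ suc t * 2)                           ≤⟨ *-monoʳ-≤ (n ^ t) (*-mono-≤ (^-monoˡ-≤ (suc t) dense) 2≤z) ⟩
        n ^ t * ((size E? * z ^ b) ^ suc t * z)           ≡⟨ cong (λ e → n ^ t * (e * z)) (trans (^-distribʳ-* (size E?) (z ^ b) (suc t))
                                                               (cong (size E? ^ suc t *_) (^-*-assoc z b (suc t)))) ⟩
        n ^ t * (size E? ^ suc t * z ^ (b * suc t) * z)   ≡⟨ e₂ (n ^ t) (size E? ^ suc t) (z ^ (b * suc t)) z ⟩
        n ^ t * size E? ^ suc t * Z                       ≤⟨ *-monoˡ-≤ Z (∑-size-restrict t) ⟩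
        X ^ t * S * Z                                     ≡⟨ *-assoc (X ^ t) S Z ⟩
        X ^ t * (S * Z)                                   ∎)
        where
        e₁ : ∀ a b c → a * (2 * b * c) ≡ b * (c * a * 2)
        e₁ = solve-∀
        e₂ : ∀ a b c d → a * (b * c * d) ≡ a * b * (d * c)
        e₂ = solve-∀
      average : ∑ (tuples V t) (λ T → X + penalty D M T * (X * Z)) <
                ∑ (tuples V t) (λ T → size (restrict? i T E?) * Z)
      average = begin-strict
        ∑ (tuples V t) (λ T → X + penalty D M T * (X * Z))   ≡⟨ ∑-+ (tuples V t) _ _ ⟩
        ∑ (tuples V t) (λ _ → X) + ∑ (tuples V t) (λ T → penalty D M T * (X * Z))
          ≡⟨ cong₂ _+_ (trans (∑-const (tuples V t) X) (cong (_* X) (trans (length-tuples V t) (cong (_^ t) |V|))))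
                       (∑-*ʳ (X * Z) (tuples V t) _) ⟩
        n ^ t * X + C * (X * Z)                              ≡⟨ e₃ (n ^ t) X C Z ⟩
        (n ^ t + C * Z) * X                                  <⟨ *-monoˡ-< X (+-monoʳ-< (n ^ t) CZ<n^t) ⟩
        (n ^ t + n ^ t) * X                                  ≡⟨ e₄ (n ^ t) X ⟩
        2 * n ^ t * X                                        ≤⟨ total ⟩
        S * Z                                                ≡⟨ ∑-*ʳ Z (tuples V t) _ ⟨
        ∑ (tuples V t) (λ T → size (restrict? i T E?) * Z)   ∎
        where
        e₃ : ∀ a b c d → a * b + c * (b * d) ≡ (a + c * d) * b
        e₃ = solve-∀
        e₄ : ∀ a b → (a + a) * b ≡ 2 * a * b
        e₄ = solve-∀
    ... | T , lt with penalty D M T in eq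
    ...   | zero  = T , unpenalised⇒expands D M T eq , ≤-trans (≤-reflexive (sym (+-identityʳ _))) (<⇒≤ lt)
    ...   | suc c = contradiction lt (≤⇒≯ (begin
      size (restrict? i T E?) * Z         ≤⟨ *-monoˡ-≤ Z (size≤ (restrict? i T E?)) ⟩
      n ^ k * Z                           ≤⟨ m≤m+n _ (c * (n ^ k * Z)) ⟩
      n ^ k * Z + c * (n ^ k * Z)         ≤⟨ m≤n+m _ (n ^ k) ⟩
      n ^ k + suc c * (n ^ k * Z)         ∎))
      where
      open ≤-Reasoning
      Z = z ^ suc (b * suc t)

-- Processing the coordinates one after another

module Regularise {k n : ℕ} (o : Fin n) (D M B Q z : ℕ) (2≤D : 2 ≤ D) (1≤M : 1 ≤ M)
                  (z^Q≤n : z ^ Q ≤ n) (z-large : 2 ^ (suc B ^ k) * M ^ B < z) where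

  private instance
    n≢0 : NonZero n
    n≢0 = Fin.nonZeroIndex o
    M≢0 : NonZero M
    M≢0 = >-nonZero 1≤M

  1<z : 1 < z
  1<z = ≤-<-trans (*-mono-≤ (m^n>0 2 (suc B ^ k)) (m^n>0 M B)) z-large

  private instance
    z≢0 : NonZero z
    z≢0 = >-nonZero (<-trans z<s 1<z)

  D≤4^ : ∀ l → D ≤ 4^[ l ]* D
  D≤4^ zero    = ≤-refl
  D≤4^ (suc l) = ≤-trans (D≤4^ l) (m≤n*m (4^[ l ]* D) 4)

  -- With sample length `3 * D′`, a power `n ^ (2 * D′)` remains after the choices of `N`. It is at
  -- least `z ^ (Q * (2 * D′))`, which covers the density loss and one more `z` that absorbs the
  -- constants.
  room : ∀ b D′ → 1 ≤ D′ → 4 * D′ ≤ B → 2 * b + 2 ≤ Q →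
         n ^ D′ * (2 ^ (suc D′ ^ k) * M ^ (3 * D′)) * z ^ suc (b * suc (3 * D′)) < n ^ (3 * D′)
  room b D′ 1≤D′ 4D′≤B 2b+2≤Q = begin-strict
    n ^ D′ * (2 ^ (suc D′ ^ k) * M ^ (3 * D′)) * z ^ b′    ≤⟨ *-monoˡ-≤ (z ^ b′) (*-monoʳ-≤ (n ^ D′) (*-mono-≤
                                                                (^-monoʳ-≤ 2 (^-monoˡ-≤ k (s≤s (≤-trans (m≤n*m D′ 4) 4D′≤B))))
                                                                (^-monoʳ-≤ M (≤-trans (*-monoˡ-≤ D′ (n≤1+n 3)) 4D′≤B)))) ⟩
    n ^ D′ * (2 ^ (suc B ^ k) * M ^ B) * z ^ b′            <⟨ *-monoˡ-< (z ^ b′) {{m^n≢0 z b′}} (*-monoʳ-< (n ^ D′) {{m^n≢0 n D′}} z-large) ⟩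
    n ^ D′ * z * z ^ b′                                    ≡⟨ *-assoc (n ^ D′) z (z ^ b′) ⟩
    n ^ D′ * z ^ suc b′                                    ≤⟨ *-monoʳ-≤ (n ^ D′) (^-monoʳ-≤ z exponent) ⟩
    n ^ D′ * z ^ (Q * (2 * D′))                            ≡⟨ cong (n ^ D′ *_) (^-*-assoc z Q (2 * D′)) ⟨
    n ^ D′ * (z ^ Q) ^ (2 * D′)                            ≤⟨ *-monoʳ-≤ (n ^ D′) (^-monoˡ-≤ (2 * D′) z^Q≤n) ⟩
    n ^ D′ * n ^ (2 * D′)                                  ≡⟨ ^-distribˡ-+-* n D′ (2 * D′) ⟨
    n ^ (3 * D′)                                           ∎
    where
    open ≤-Reasoning
    b′ = suc (b * suc (3 * D′))
    e₁ : ∀ b D → suc (suc (b * suc (3 * D))) ≡ b * 1 + (2 * 1 + b * (3 * D))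
    e₁ = solve-∀
    e₂ : ∀ b D → b * D + (4 * D + b * (3 * D)) ≡ (2 * b + 2) * (2 * D)
    e₂ = solve-∀
    exponent : suc b′ ≤ Q * (2 * D′)
    exponent = begin
      suc b′                                 ≡⟨ e₁ b D′ ⟩
      b * 1 + (2 * 1 + b * (3 * D′))         ≤⟨ +-mono-≤ (*-monoʳ-≤ b 1≤D′) (+-monoˡ-≤ _ (*-mono-≤ (s≤s (s≤s (z≤n {2}))) 1≤D′)) ⟩
      b * D′ + (4 * D′ + b * (3 * D′))       ≡⟨ e₂ b D′ ⟩
      (2 * b + 2) * (2 * D′)                 ≤⟨ *-monoˡ-≤ (2 * D′) 2b+2≤Q ⟩
      Q * (2 * D′)                           ∎

  exponent-growth : ∀ b D′ → 1 ≤ b → 2 ≤ D′ → 4 * D′ ≤ B → suc (b * suc (3 * D′)) ≤ b * B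
  exponent-growth b D′ 1≤b 2≤D′ 4D′≤B = begin
    suc (b * suc (3 * D′))             ≡⟨ e₁ b D′ ⟩
    1 + (b + b * (3 * D′))             ≤⟨ +-monoˡ-≤ _ 1≤b ⟩
    b + (b + b * (3 * D′))             ≡⟨ e₂ b D′ ⟩
    b * (2 + 3 * D′)                   ≤⟨ *-monoʳ-≤ b (+-monoˡ-≤ (3 * D′) 2≤D′) ⟩
    b * (4 * D′)                       ≤⟨ *-monoʳ-≤ b 4D′≤B ⟩
    b * B                              ∎
    where
    open ≤-Reasoning
    e₁ : ∀ b D → suc (b * suc (3 * D)) ≡ 1 + (b + b * (3 * D))
    e₁ = solve-∀
    e₂ : ∀ b D → b + (b + b * (3 * D)) ≡ b * (2 + 3 * D)
    e₂ = solve-∀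

  -- Density is measured by `b` in `n ^ k ≤ size * z ^ b`, and a step multiplies `b` by at most `B`.
  -- Inherited expansion falls from `4 * D′` to `D′` vertices because the sample takes up `3 * D′`
  -- of them.
  record Step (i₁ : Fin k) (b D′ : ℕ) (E : Vec (Fin n) k → Set) : Set₁ where
    field
      E₁       : Vec (Fin n) k → Set
      E₁?      : ∀ x → Dec (E₁ x)
      E₁⊆E     : ∀ x → E₁ x → E x
      dense    : n ^ k ≤ size E₁? * z ^ (b * B)
      created  : Expands i₁ D′ M E₁
      inherits : ∀ i → i ≢ i₁ → Expands i (4 * D′) M E → Expands i D′ M E₁

  step : ∀ i₁ b D′ → 1 ≤ b → 2 ≤ D′ → 4 * D′ ≤ B → 2 * b + 2 ≤ Q →
         {E : Vec (Fin n) k → Set} (E? : ∀ x → Dec (E x)) → n ^ k ≤ size E? * z ^ b → Step i₁ b D′ E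
  step i₁ b D′ 1≤b 2≤D′ 4D′≤B 2b+2≤Q {E} E? dense = from-sample
    (Sampling.sample o i₁ E? {3 * D′} D′ M z b 1<z dense (room b D′ (≤-trans (n≤1+n 1) 2≤D′) 4D′≤B 2b+2≤Q))
    where
    from-sample : (∃ λ (T : Vec (Fin n) (3 * D′)) → Expands i₁ D′ M (Restrict i₁ T E) ×
                     n ^ k ≤ size (restrict? i₁ T E?) * z ^ suc (b * suc (3 * D′))) → Step i₁ b D′ E
    from-sample (T , ex , dense′) = record
      { E₁?      = restrict? i₁ T E?
      ; E₁⊆E     = λ x → proj₁
      ; dense    = ≤-trans dense′ (*-monoʳ-≤ (size (restrict? i₁ T E?)) (^-monoʳ-≤ z {{>-nonZero (<-trans z<s 1<z)}}
                     (exponent-growth b D′ 1≤b 2≤D′ 4D′≤B)))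
      ; created  = ex
      ; inherits = λ i i≢i₁ → expands-restrict {i = i} {D = D′} {t = 3 * D′} T i≢i₁
      }

  -- The disjunction is the induction invariant: the coordinates in `is` are still to be processed,
  -- and those processed earlier enter through expansion for `D₀` vertices.
  Regular : List (Fin k) → ℕ → (Vec (Fin n) k → Set) → Set₁
  Regular is D₀ E = Σ (Vec (Fin n) k → Set) λ E′ → ∃ E′ × (∀ x → E′ x → E x) ×
                 (∀ i → i ∈ₗ is ⊎ Expands i D₀ M E → Expands i D M E′)

  module _ (i₁ : Fin k) {is : List (Fin k)} {b D′ : ℕ} {E : Vec (Fin n) k → Set} (s : Step i₁ b D′ E) where
    open Step s

    regular-step : Regular is D′ E₁ → Regular (i₁ ∷ is) (4 * D′) E
    regular-step (E′ , nonempty , E′⊆E₁ , ex) = E′ , nonempty , (λ x E′x → E₁⊆E x (E′⊆E₁ x E′x)) , expands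
      where
      expands : ∀ i → i ∈ₗ i₁ ∷ is ⊎ Expands i (4 * D′) M E → Expands i D M E′
      expands i h with i Fin.≟ i₁ | h
      ... | yes refl | _                  = ex i (inj₂ created)
      ... | no i≢i₁ | inj₁ (here i≡i₁)    = contradiction i≡i₁ i≢i₁
      ... | no i≢i₁ | inj₁ (there i∈is)   = ex i (inj₁ i∈is)
      ... | no i≢i₁ | inj₂ exE            = ex i (inj₂ (inherits i i≢i₁ exE))

  -- Only the exponents before each step are constrained by `Q`; the largest is `b * B ^ l` with `l`
  -- one less than the number of coordinates. After the last step the density only has to rule out
  -- an empty relation. This saves one factor `B`.
  regularise : (is : List (Fin k)) (b : ℕ) → 1 ≤ b → 4^[ length is ]* D ≤ B →
               (∀ l → length is ≡ suc l → 2 * (b * B ^ l) + 2 ≤ Q) →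
               {E : Vec (Fin n) k → Set} (E? : ∀ x → Dec (E x)) → n ^ k ≤ size E? * z ^ b →
               Regular is (4^[ length is ]* D) E
  regularise [] b _ _ _ {E} E? dense = E , nonempty , (λ _ Ex → Ex) , λ { i (inj₂ ex) → ex }
    where
    nonempty : ∃ E
    nonempty with any? E? (tuples (allFin n) k)
    ... | yes p = satisfied p
    ... | no ¬p = contradiction dense (<⇒≱ (≤-<-trans (≤-reflexive (cong (_* z ^ b) size≡0)) (m^n>0 n k)))
      where
      size≡0 : size E? ≡ 0
      size≡0 = n≤0⇒n≡0 (≤-trans (∑-mono (tuples (allFin n) k)
        (λ x x∈ → ≤-reflexive (𝟙-no (E? x) (λ Ex → ¬p (loseₗ x∈ Ex))))) (≤-reflexive (∑-zero (tuples (allFin n) k))))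
  regularise (i₁ ∷ is) b 1≤b 4D′≤B steps E? dense =
    regular-step i₁ first
      (regularise is (b * B) (*-mono-≤ 1≤b 1≤B) D′≤B
        (λ l eq → subst (λ e → 2 * e + 2 ≤ Q) (sym (*-assoc b B (B ^ l))) (steps (suc l) (cong suc eq)))
        (Step.E₁? first) (Step.dense first))
    where
    D′ = 4^[ length is ]* D
    D′≤B : D′ ≤ B
    D′≤B = ≤-trans (m≤n*m D′ 4) 4D′≤B
    2≤D′ : 2 ≤ D′
    2≤D′ = ≤-trans 2≤D (D≤4^ (length is))
    1≤B : 1 ≤ B
    1≤B = ≤-trans (≤-trans (n≤1+n 1) 2≤D′) D′≤B
    2b+2≤Q : 2 * b + 2 ≤ Q
    2b+2≤Q = ≤-trans (+-monoˡ-≤ 2 (*-monoʳ-≤ 2 (m≤m*n b (B ^ length is) {{m^n≢0 B (length is) {{>-nonZero 1≤B}}}})))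
                     (steps (length is) refl)
    first : Step i₁ b D′ _
    first = step i₁ b D′ 1≤b 2≤D′ 4D′≤B 2b+2≤Q E? dense

-- Embedding along a degenerate ordering

any-true : {A : Set} (p : A → Bool) {xs : List A} {x : A} → x ∈ₗ xs → p x ≡ true → any p xs ≡ true
any-true p {x ∷ xs} (here refl) px rewrite px = refl
any-true p {x ∷ xs} (there x∈) px with p x
... | true  = refl
... | false = any-true p x∈ px

adjacent : ∀ {k m} (H : Hypergraph k m) {e u v} → e ∈ₗ edges H → u ∈ e → v ∈ e → u ≢ v → adj₁ H u v ≡ true
adjacent H {e} {u} {v} e∈ u∈e v∈e u≢v with u Fin.≟ v
... | yes u≡v = contradiction u≡v u≢v
... | no _    = any-true _ e∈ (cong₂ _∧_ ([]=⇒lookup u∈e) ([]=⇒lookup v∈e))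

-- `Expands` takes exactly `D` vertices, so a shorter list is filled up with copies of `a`.
pad : {A : Set} {D : ℕ} (xs : List A) → A → length xs ≤ D → ∃ λ (N : Vec A D) → ∀ {x} → x ∈ₗ xs → x ∈ᵥ N
pad {D = D}     []       a _         = Vec.replicate D a , λ ()
pad {D = suc D} (x ∷ xs) a (s≤s len) with pad xs a len
... | N , xs⊆N = x ∷ N , λ { (here eq) → VAny.here eq ; (there x∈) → VAny.there (xs⊆N x∈) }

module Partite {k m : ℕ} (H : Hypergraph k m) (kp : KPartite H) where

  part : Fin m → Fin k
  part = kp .proj₁

  module _ {e} (e∈ : e ∈ₗ edges H) (j : Fin k) where
    vertex : Fin m
    vertex = kp .proj₂ e e∈ j .proj₁

    vertex∈ : vertex ∈ e
    vertex∈ = kp .proj₂ e e∈ j .proj₂ .proj₁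

    part-vertex : part vertex ≡ j
    part-vertex = kp .proj₂ e e∈ j .proj₂ .proj₂ .proj₁

    vertex-unique : ∀ v → v ∈ e → part v ≡ j → v ≡ vertex
    vertex-unique = kp .proj₂ e e∈ j .proj₂ .proj₂ .proj₂

  image : {A : Set} → (Fin m → A) → ∀ {e} → e ∈ₗ edges H → Vec A k
  image φ e∈ = tabulate (λ j → φ (vertex e∈ j))

  -- Apply degeneracy to the vertex set of a single edge: since `k ≥ 2`, each of its vertices has a
  -- neighbour in the edge, in another part.
  1≤degeneracy : ∀ {d} → 2 ≤ k → 2 ≤ e[ H ] → DegenerateBy₁ H d → 1 ≤ d
  1≤degeneracy {d} (s≤s (s≤s z≤n)) 2≤e deg with some-edge (edges H) 2≤e
    where
    some-edge : ∀ es → 2 ≤ length es → ∃ λ e → e ∈ₗ es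
    some-edge (e ∷ _) _ = e , here refl
  ... | e , e∈ with deg e (vertex e∈ zero , vertex∈ e∈ zero)
  ...   | v , v∈e , deg≤d = ≤-trans (neighbour (part v) refl) deg≤d
    where
    positive : ∀ j → j ≢ part v → 1 ≤ deg₁ H e v
    positive j j≢ = ≤-trans (≤-reflexive (sym (cong (if_then 1 else 0)
        (cong₂ _∧_ ([]=⇒lookup (vertex∈ e∈ j)) (adjacent H e∈ (vertex∈ e∈ j) v∈e u≢v)))))
      (∑-∈ (λ u → if lookup e u ∧ adj₁ H u v then 1 else 0) (∈-allFin (vertex e∈ j)))
      where
      u≢v : vertex e∈ j ≢ v
      u≢v u≡v = j≢ (trans (sym (part-vertex e∈ j)) (cong part u≡v))
    neighbour : ∀ i → part v ≡ i → 1 ≤ deg₁ H e v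
    neighbour zero    pv = positive (suc zero) (λ h → contradiction (trans h pv) λ ())
    neighbour (suc i) pv = positive zero (λ h → contradiction (trans h pv) λ ())

  module Embed {n d D : ℕ} {E : Vec (Fin n) k → Set} (degenerate : DegenerateBy₁ H d) (d+k≤D : d + k ≤ D)
               (x₀ : Vec (Fin n) k) (Ex₀ : E x₀) (expands : ∀ i → Expands i D (suc m) E) where

    -- Vertices outside `S` wait at the entry of `x₀` for their part. They may collide there, but
    -- every edge of `H` already maps to a tuple of `E`.
    record Partial (S : Subset m) : Set where
      field
        φ         : Fin m → Fin n
        anchored  : ∀ v → v ∉ S → φ v ≡ lookup x₀ (part v)
        injective : ∀ u v → u ∈ S → v ∈ S → φ u ≡ φ v → u ≡ v
        tuples∈E  : ∀ {e} (e∈ : e ∈ₗ edges H) → E (image φ e∈)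

    anchor : ∀ S → ¬ Nonempty S → Partial S
    anchor S empty = record
      { φ         = λ v → lookup x₀ (part v)
      ; anchored  = λ _ _ → refl
      ; injective = λ u _ u∈ → contradiction (u , u∈) empty
      ; tuples∈E  = λ e∈ → subst E (sym (trans (tabulate-cong (λ j → cong (lookup x₀) (part-vertex e∈ j))) (tabulate∘lookup x₀))) Ex₀
      }

    module _ (S : Subset m) (v : Fin m) (v∈S : v ∈ S) (deg≤d : deg₁ H S v ≤ d) (partial : Partial (S - v)) where
      open Partial partial

      S-neighbour? : ∀ u → Dec (lookup S u ∧ adj₁ H u v ≡ true)
      S-neighbour? u = (lookup S u ∧ adj₁ H u v) Bool.≟ true

      neighbours : List (Fin m)
      neighbours = filter S-neighbour? (allFin m)

      -- The other vertices of an edge through `v` are neighbours of `v` in `S`, or lie outside `S`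
      -- and sit at entries of `x₀`. This gives at most `d + k` positions.
      relevant : List (Fin n)
      relevant = List.map φ neighbours ++ toList x₀

      length-relevant : length relevant ≤ D
      length-relevant = begin
        length relevant                                              ≡⟨ length-++ (List.map φ neighbours) ⟩
        length (List.map φ neighbours) + length (toList x₀)          ≡⟨ cong₂ _+_ (trans (length-map φ neighbours) (∑-filter S-neighbour? (allFin m))) (Vec.length-toList x₀) ⟩
        ∑ (allFin m) (λ u → 𝟙 (S-neighbour? u)) + k                  ≡⟨ cong (_+ k) (∑-cong (allFin m) (λ u → same (lookup S u ∧ adj₁ H u v))) ⟩
        deg₁ H S v + k                                               ≤⟨ +-monoˡ-≤ k deg≤d ⟩
        d + k                                                        ≤⟨ d+k≤D ⟩
        D                                                            ∎
        where
        open ≤-Reasoning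
        same : ∀ b → 𝟙 (b Bool.≟ true) ≡ (if b then 1 else 0)
        same true  = refl
        same false = refl

      i : Fin k
      i = part v

      padded : ∃ λ (N : Vec (Fin n) D) → ∀ {x} → x ∈ₗ relevant → x ∈ᵥ N
      padded = pad relevant (lookup x₀ i) length-relevant

      N = padded .proj₁

      extension : ∃ λ w → w ∉ₗ List.map φ (allFin m) × (∀ x → E x → (∀ j → j ≢ i → lookup x j ∈ᵥ N) → E (x [ i ]≔ w))
      -- All `m` current positions are avoided, which is why expansion is required for `M = suc m`.
      extension = expands i N (List.map φ (allFin m))
        (s≤s (≤-reflexive (trans (length-map φ (allFin m)) (length-tabulate id))))

      w = extension .proj₁

      ψ : Fin m → Fin n
      ψ u = if does (u Fin.≟ v) then w else φ u

      ψ-new : ψ v ≡ w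
      ψ-new = cong (if_then w else φ v) (dec-true (v Fin.≟ v) refl)

      ψ-old : ∀ {u} → u ≢ v → ψ u ≡ φ u
      ψ-old {u} u≢v = cong (if_then w else φ u) (dec-false (u Fin.≟ v) u≢v)

      φ≢w : ∀ u → φ u ≢ w
      φ≢w u eq = extension .proj₂ .proj₁ (subst (_∈ₗ List.map φ (allFin m)) eq (∈-map⁺ φ (∈-allFin u)))

      ∉-shrink : ∀ {u} → u ∉ S → u ∉ S - v
      ∉-shrink u∉S u∈ = u∉S (p─q⊆p S _ u∈)

      ψ-injective : ∀ u u′ → u ∈ S → u′ ∈ S → ψ u ≡ ψ u′ → u ≡ u′
      ψ-injective u u′ u∈ u′∈ eq = cases (u Fin.≟ v) (u′ Fin.≟ v)
        where
        cases : Dec (u ≡ v) → Dec (u′ ≡ v) → u ≡ u′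
        cases (yes refl) (yes refl) = refl
        cases (yes refl) (no u′≢v)  = contradiction (trans (sym (ψ-old u′≢v)) (trans (sym eq) ψ-new)) (φ≢w u′)
        cases (no u≢v)   (yes refl) = contradiction (trans (sym (ψ-old u≢v)) (trans eq ψ-new)) (φ≢w u)
        cases (no u≢v)   (no u′≢v)  = injective u u′ (x∈p∧x≢y⇒x∈p-y u∈ u≢v) (x∈p∧x≢y⇒x∈p-y u′∈ u′≢v)
          (trans (sym (ψ-old u≢v)) (trans eq (ψ-old u′≢v)))

      module _ {e} (e∈ : e ∈ₗ edges H) where

        relevant-entry : v ∈ e → ∀ j → j ≢ i → lookup (image φ e∈) j ∈ᵥ N
        relevant-entry v∈e j j≢i = subst (_∈ᵥ N) (sym (lookup∘tabulate (λ j → φ (vertex e∈ j)) j)) (padded .proj₂ entry)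
          where
          u = vertex e∈ j
          u≢v : u ≢ v
          u≢v u≡v = j≢i (trans (sym (part-vertex e∈ j)) (cong part u≡v))
          entry : φ u ∈ₗ relevant
          entry with u Sub.∈? S
          ... | yes u∈S = ∈-++⁺ˡ (∈-map⁺ φ (∈-filter⁺ S-neighbour? (∈-allFin u)
                            (cong₂ _∧_ ([]=⇒lookup u∈S) (adjacent H e∈ (vertex∈ e∈ j) v∈e u≢v))))
          ... | no u∉S  = ∈-++⁺ʳ (List.map φ neighbours) (subst (_∈ₗ toList x₀) (sym (anchored u (∉-shrink u∉S)))
                            (∈-toList⁺ (VMem.∈-lookup (part u) x₀)))

        -- `v` is the only vertex of `e` in its part, so moving `v` changes the tuple of `e` at the
        -- entry `i` alone.
        image-update : v ∈ e → image ψ e∈ ≡ image φ e∈ [ i ]≔ w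
        image-update v∈e = trans (tabulate-cong pointwise) (tabulate∘lookup (image φ e∈ [ i ]≔ w))
          where
          pointwise : ∀ j → ψ (vertex e∈ j) ≡ lookup (image φ e∈ [ i ]≔ w) j
          pointwise j with j Fin.≟ i
          ... | yes refl = trans (trans (cong ψ (sym (vertex-unique e∈ i v v∈e refl))) ψ-new)
                             (sym (lookup∘update i (image φ e∈) w))
          ... | no j≢i   = trans (ψ-old (λ u≡v → j≢i (trans (sym (part-vertex e∈ j)) (cong part u≡v))))
                             (sym (trans (lookup∘update′ j≢i (image φ e∈) w) (lookup∘tabulate (λ j → φ (vertex e∈ j)) j)))

        ψ-tuples∈E : E (image ψ e∈)
        ψ-tuples∈E with v Sub.∈? e
        ... | yes v∈e = subst E (sym (image-update v∈e))
                          (extension .proj₂ .proj₂ (image φ e∈) (tuples∈E e∈) (relevant-entry v∈e))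
        ... | no v∉e  = subst E (tabulate-cong (λ j → sym (ψ-old (λ u≡v → v∉e (subst (_∈ e) u≡v (vertex∈ e∈ j)))))) (tuples∈E e∈)

      extend : Partial S
      extend = record
        { φ         = ψ
        ; anchored  = λ u u∉S → trans (ψ-old (λ { refl → u∉S v∈S })) (anchored u (∉-shrink u∉S))
        ; injective = ψ-injective
        ; tuples∈E  = ψ-tuples∈E
        }

    partial-embedding : ∀ s S → ∣ S ∣ ≤ s → Partial S
    partial-embedding zero S ∣S∣≤0 = anchor S λ (v , v∈S) → contradiction (x∈p⇒∣p-x∣<∣p∣ v∈S) (≤⇒≯ (≤-trans ∣S∣≤0 z≤n))
    partial-embedding (suc s) S ∣S∣≤ with nonempty? S
    ... | no empty = anchor S empty
    -- The vertex of small degree in `S` is placed after the rest of `S`, when its neighbours in `S`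
    -- already have their positions.
    ... | yes ne with degenerate S ne
    ...   | v , v∈S , deg≤d = extend S v v∈S deg≤d (partial-embedding s (S - v) (≤-pred (≤-trans (x∈p⇒∣p-x∣<∣p∣ v∈S) ∣S∣≤)))

    embedding : ∃ λ (φ : Fin m → Fin n) → Injective _≡_ _≡_ φ × (∀ {e} (e∈ : e ∈ₗ edges H) → E (image φ e∈))
    embedding = φ , (λ {u} {v} → injective u v ∈⊤ ∈⊤) , tuples∈E
      where open Partial (partial-embedding m full (≤-reflexive (∣⊤∣≡n m)))

-- Edges as ordered tuples

enumerate : ∀ {n} (S : Subset n) → Vec (Fin n) ∣ S ∣
enumerate []            = []
enumerate (inside  ∷ S) = zero ∷ Vec.map suc (enumerate S)
enumerate (outside ∷ S) = Vec.map suc (enumerate S)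

∈-enumerate⁺ : ∀ {n} {S : Subset n} {j} → j ∈ S → j ∈ᵥ enumerate S
∈-enumerate⁺ {S = inside  ∷ S} here       = VAny.here refl
∈-enumerate⁺ {S = inside  ∷ S} (there j∈) = VAny.there (VMem.∈-map⁺ suc (∈-enumerate⁺ j∈))
∈-enumerate⁺ {S = outside ∷ S} (there j∈) = VMem.∈-map⁺ suc (∈-enumerate⁺ j∈)

enumerate-∈ : ∀ {n} (S : Subset n) a → lookup (enumerate S) a ∈ S
enumerate-∈ (inside  ∷ S) zero    = here
enumerate-∈ (inside  ∷ S) (suc a) = subst (_∈ (inside ∷ S)) (sym (Vec.lookup-map a suc (enumerate S))) (there (enumerate-∈ S a))
enumerate-∈ (outside ∷ S) a       = subst (_∈ (outside ∷ S)) (sym (Vec.lookup-map a suc (enumerate S))) (there (enumerate-∈ S a))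

∈ᵥ⇒lookup : ∀ {A : Set} {n} {x : A} {v : Vec A n} → x ∈ᵥ v → ∃ λ a → lookup v a ≡ x
∈ᵥ⇒lookup x∈ = VAny.index x∈ , sym (VAnyP.lookup-index x∈)

module _ {n : ℕ} where

  infix 4 _∈ᵥ?_
  _∈ᵥ?_ : ∀ {k} (j : Fin n) (x : Vec (Fin n) k) → Dec (j ∈ᵥ x)
  j ∈ᵥ? x = DecVMem._∈?_ Fin._≟_ j x

  _≟ₛ_ : (S S′ : Subset n) → Dec (S ≡ S′)
  _≟ₛ_ = Vec.≡-dec Bool._≟_

  support : ∀ {k} → Vec (Fin n) k → Subset n
  support x = tabulate (λ j → does (j ∈ᵥ? x))

  ∈-support⁺ : ∀ {k} {x : Vec (Fin n) k} {j} → j ∈ᵥ x → j ∈ support x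
  ∈-support⁺ {x = x} {j} j∈ = lookup⇒[]= j (support x) (trans (lookup∘tabulate _ j) (dec-true (j ∈ᵥ? x) j∈))

  ∈-support⁻ : ∀ {k} (x : Vec (Fin n) k) {j} → j ∈ support x → j ∈ᵥ x
  ∈-support⁻ x {j} j∈ with j ∈ᵥ? x | trans (sym (lookup∘tabulate (λ j → does (j ∈ᵥ? x)) j)) ([]=⇒lookup j∈)
  ... | yes p | _ = p

  support-enumerate : ∀ S → support (enumerate S) ≡ S
  support-enumerate S = ⊆-antisym
    (λ j∈ → let a , eq = ∈ᵥ⇒lookup (∈-support⁻ (enumerate S) j∈) in subst (_∈ S) eq (enumerate-∈ S a))
    (λ j∈ → ∈-support⁺ (∈-enumerate⁺ j∈))

  module _ {k : ℕ} (G : Hypergraph k n) where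

    Supported : Vec (Fin n) k → Set
    Supported x = Any (support x ≡_) (edges G)

    supported? : ∀ x → Dec (Supported x)
    supported? x = any? (support x ≟ₛ_) (edges G)

    -- Every edge is the support of at least one tuple, its enumeration, and a tuple supports at
    -- most one of the distinct edges.
    edges≤size : e[ G ] ≤ size supported?
    edges≤size = begin
      e[ G ]                                                        ≡⟨ *-identityʳ _ ⟨
      e[ G ] * 1                                                    ≡⟨ ∑-const (edges G) 1 ⟨
      ∑ (edges G) (λ _ → 1)                                         ≤⟨ ∑-mono (edges G) hit ⟩
      ∑ (edges G) (λ e → ∑ Vᵏ (λ x → 𝟙 (support x ≟ₛ e)))           ≡⟨ ∑-swap (edges G) Vᵏ _ ⟩
      ∑ Vᵏ (λ x → ∑ (edges G) (λ e → 𝟙 (support x ≟ₛ e)))           ≤⟨ ∑-mono Vᵏ (λ x _ → ∑-𝟙-unique _≟ₛ_ (support x) (distinct G)) ⟩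
      size supported?                                               ∎
      where
      open ≤-Reasoning
      Vᵏ = tuples (allFin n) k
      tuple : ∀ e {l} → ∣ e ∣ ≡ l → ∃ λ (x : Vec (Fin n) l) → support x ≡ e
      tuple e refl = enumerate e , support-enumerate e
      hit : ∀ e → e ∈ₗ edges G → 1 ≤ ∑ Vᵏ (λ x → 𝟙 (support x ≟ₛ e))
      hit e e∈ with tuple e (All.lookup (uniform G) e∈)
      ... | x , eq = ≤-trans (≤-reflexive (sym (𝟙-yes (support x ≟ₛ e) eq)))
        (∑-∈ (λ x → 𝟙 (support x ≟ₛ e)) (∈-tuples x (λ a → ∈-allFin (lookup x a))))

module _ {k m n : ℕ} (G : Hypergraph k n) (H : Hypergraph k m) (kp : KPartite H) where
  open Partite H kp

  supported⇒contains : (φ : Fin m → Fin n) → Injective _≡_ _≡_ φ →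
                       (∀ {e} (e∈ : e ∈ₗ edges H) → Supported G (image φ e∈)) → Contains G H
  supported⇒contains φ φ-inj sup = φ , φ-inj , λ e e∈ →
    support (image φ e∈) , sup e∈ , λ j → mk⇔
      (λ j∈ → let a , eq = ∈ᵥ⇒lookup (∈-support⁻ (image φ e∈) j∈) in
        vertex e∈ a , vertex∈ e∈ a , trans (sym (lookup∘tabulate (λ j → φ (vertex e∈ j)) a)) eq)
      (λ { (i , i∈e , refl) → ∈-support⁺ (subst (λ u → φ u ∈ᵥ image φ e∈)
        (sym (vertex-unique e∈ (part i) i i∈e refl)) (VMem.∈-tabulate⁺ (λ a → φ (vertex e∈ a)) (part i))) })

-- The upper bound

4^*≡ : ∀ l D → 4^[ l ]* D ≡ 4 ^ l * D
4^*≡ zero    D = sym (+-identityʳ D)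
4^*≡ (suc l) D = trans (cong (4 *_) (4^*≡ l D)) (sym (*-assoc 4 (4 ^ l) D))

-- For `B = 4 ^ k * suc k * d` this is the part of `4 * B ^ (k ∸ 1)` that depends on `k` alone; the
-- other factor is `d ^ (k ∸ 1)`. Its reciprocal serves as `c_k`.
upper-exponent : ℕ → ℕ
upper-exponent k = 4 * (4 ^ k * suc k) ^ (k ∸ 1)

module Upper {k m : ℕ} (2≤k : 2 ≤ k) (H : Hypergraph k m) (kp : KPartite H) (2≤e : 2 ≤ e[ H ]) (d : ℕ) (degenerate : DegenerateBy₁ H d) where
  open Partite H kp

  c D B Q : ℕ
  c = 4 ^ k * suc k
  -- At least `d + k` because `d ≥ 1`; a multiple of `d`, so that `B` is `d` times a function of
  -- `k`.
  D = suc k * d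
  B = 4^[ k ]* D
  Q = upper-exponent k * d ^ (k ∸ 1)

  Z : ℕ
  Z = 2 ^ (suc B ^ k) * suc m ^ B

  1≤d : 1 ≤ d
  1≤d = 1≤degeneracy 2≤k 2≤e degenerate

  d+k≤D : d + k ≤ D
  d+k≤D = +-monoʳ-≤ d (m≤m*n k d {{>-nonZero 1≤d}})

  2≤D : 2 ≤ D
  2≤D = ≤-trans (≤-trans 2≤k (m≤n+m k d)) d+k≤D

  4B^≤Q : 4 * B ^ (k ∸ 1) ≤ Q
  4B^≤Q = ≤-reflexive (begin
    4 * B ^ (k ∸ 1)                      ≡⟨ cong (λ e → 4 * e ^ (k ∸ 1)) (trans (4^*≡ k D) (sym (*-assoc (4 ^ k) (suc k) d))) ⟩
    4 * (c * d) ^ (k ∸ 1)                ≡⟨ cong (4 *_) (^-distribʳ-* c d (k ∸ 1)) ⟩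
    4 * (c ^ (k ∸ 1) * d ^ (k ∸ 1))      ≡⟨ *-assoc 4 (c ^ (k ∸ 1)) (d ^ (k ∸ 1)) ⟨
    Q                                    ∎)
    where open ≡-Reasoning

  1≤B : 1 ≤ B
  1≤B = ≤-trans (≤-trans (n≤1+n 1) 2≤D) (≤-trans (m≤n*m D (4 ^ k) {{m^n≢0 4 k}}) (≤-reflexive (sym (4^*≡ k D))))

  steps : ∀ l → length (allFin k) ≡ suc l → 2 * (1 * B ^ l) + 2 ≤ Q
  steps l eq with trans (sym (length-tabulate {n = k} id)) eq
  ... | refl = begin
    2 * (1 * B ^ l) + 2        ≡⟨ cong (λ e → 2 * e + 2) (*-identityˡ (B ^ l)) ⟩
    2 * B ^ l + 2 * 1          ≤⟨ +-monoʳ-≤ (2 * B ^ l) (*-monoʳ-≤ 2 (m^n>0 B {{>-nonZero 1≤B}} l)) ⟩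
    2 * B ^ l + 2 * B ^ l      ≡⟨ *-distribʳ-+ (B ^ l) 2 2 ⟨
    4 * B ^ l                  ≤⟨ 4B^≤Q ⟩
    Q                          ∎
    where open ≤-Reasoning

  -- At density `1 / z` the iteration starts with `b = 1`. It makes a nonempty part of the tuple
  -- relation of `G` expand at every coordinate, and `H` is embedded there.
  dense⇒contains : ∀ {n} z (o : Fin n) → z ^ Q ≤ n → Z < z → (G : Hypergraph k n) → n ^ k ≤ e[ G ] * z → Contains G H
  dense⇒contains {n} z o z^Q≤n Z<z G dense = conclude
    (regularise (allFin k) 1 ≤-refl (≤-reflexive (cong (λ l → 4^[ l ]* D) (length-tabulate {n = k} id))) steps
      (supported? G) dense′)
    where
    open Regularise {k} o D (suc m) B Q z 2≤D (s≤s z≤n) z^Q≤n Z<z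
    dense′ : n ^ k ≤ size (supported? G) * z ^ 1
    dense′ = ≤-trans dense (*-mono-≤ (edges≤size G) (≤-reflexive (sym (*-identityʳ z))))
    conclude : Regular (allFin k) (4^[ length (allFin k) ]* D) (Supported G) → Contains G H
    conclude (E , (x₀ , Ex₀) , E⊆ , ex) =
      let φ , φ-inj , φ∈E = Embed.embedding degenerate d+k≤D x₀ Ex₀ (λ i → ex i (inj₁ (∈-allFin i)))
      in supported⇒contains G H kp φ φ-inj (λ e∈ → E⊆ _ (φ∈E e∈))

  N₀ : ℕ
  -- From here on the floor of the `Q`-th root of `n` exceeds `Z`.
  N₀ = suc Z ^ Q

  1≤Q : 1 ≤ Q
  1≤Q = ≤-trans (*-mono-≤ (s≤s (z≤n {3})) (m^n>0 B {{>-nonZero 1≤B}} (k ∸ 1))) 4B^≤Q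

  -- Let `z` be the floor of the `Q`-th root of `n`, so `n < suc z ^ Q ≤ (2 * z) ^ Q`. An extremal
  -- `G` violating the bound would have `n ^ k ≤ e[ G ] * z` and hence contain `H`. The constant 2
  -- is the rounding loss in `z`.
  upper : ∀ n t → N₀ ≤ n → IsEx n H t → t ^ Q * n ^ 1 ≤ 2 ^ Q * n ^ (k * Q)
  upper n t N₀≤n ((G , free , refl) , _) = ≮⇒≥ λ lt → free (dense⇒contains z o z^Q≤n Z<z G (dense lt))
    where
    open ≤-Reasoning
    rt = root Q 1≤Q n
    z = rt .proj₁
    z^Q≤n = rt .proj₂ .proj₁
    n<sz^Q = rt .proj₂ .proj₂
    o : Fin n
    o = fromℕ< (≤-trans (m^n>0 (suc Z) Q) N₀≤n)
    Z<z : Z < z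
    Z<z = ≰⇒> λ z≤Z → <⇒≱ n<sz^Q (≤-trans (^-monoˡ-≤ Q (s≤s z≤Z)) N₀≤n)
    sz≤2z : suc z ≤ 2 * z
    sz≤2z = ≤-trans (+-monoˡ-≤ z (≤-trans (s≤s z≤n) Z<z)) (≤-reflexive (cong (z +_) (sym (+-identityʳ z))))
    dense : 2 ^ Q * n ^ (k * Q) < e[ G ] ^ Q * n ^ 1 → n ^ k ≤ e[ G ] * z
    dense lt = ≮⇒≥ λ sparse → <⇒≱ lt (begin
      e[ G ] ^ Q * n ^ 1             ≡⟨ cong (e[ G ] ^ Q *_) (*-identityʳ n) ⟩
      e[ G ] ^ Q * n                 ≤⟨ *-monoʳ-≤ (e[ G ] ^ Q) (≤-trans (<⇒≤ n<sz^Q) (^-monoˡ-≤ Q sz≤2z)) ⟩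
      e[ G ] ^ Q * (2 * z) ^ Q       ≡⟨ ^-distribʳ-* e[ G ] (2 * z) Q ⟨
      (e[ G ] * (2 * z)) ^ Q         ≡⟨ cong (_^ Q) (shuffle e[ G ] z) ⟩
      (2 * (e[ G ] * z)) ^ Q         ≡⟨ ^-distribʳ-* 2 (e[ G ] * z) Q ⟩
      2 ^ Q * (e[ G ] * z) ^ Q       ≤⟨ *-monoʳ-≤ (2 ^ Q) (^-monoˡ-≤ Q (<⇒≤ sparse)) ⟩
      2 ^ Q * (n ^ k) ^ Q            ≡⟨ cong (2 ^ Q *_) (^-*-assoc n k Q) ⟩
      2 ^ Q * n ^ (k * Q)            ∎)
      where
      shuffle : ∀ a b → a * (2 * b) ≡ 2 * (a * b)
      shuffle = solve-∀

-- The alteration method, derandomised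

module Derandomise (l : ℕ) where

  L : ℕ
  L = suc l

  -- L ^ P times the probability that a random subset, containing each point independently with probability 1 / L, includes A.
  weight : ∀ {P} → Subset P → ℕ
  weight []            = 1
  weight (inside  ∷ A) = weight A
  weight (outside ∷ A) = L * weight A

  weight-∣∣ : ∀ {P} (A : Subset P) → weight A * L ^ ∣ A ∣ ≡ L ^ P
  weight-∣∣ []            = refl
  weight-∣∣ (inside  ∷ A) = trans (swap (weight A) L (L ^ ∣ A ∣)) (cong (L *_) (weight-∣∣ A))
    where
    swap : ∀ a b c → a * (b * c) ≡ b * (a * c)
    swap = solve-∀
  weight-∣∣ (outside ∷ A) = trans (*-assoc L (weight A) (L ^ ∣ A ∣)) (cong (L *_) (weight-∣∣ A))

  private
    Family : ℕ → Set
    Family P = List (ℕ × Subset P)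

    expected : ∀ {P} → Family P → ℕ
    expected F = ∑ F (λ (c , A) → c * weight A)

    covered : ∀ {P} → Subset P → Family P → ℕ
    covered X F = ∑ F (λ (c , A) → c * 𝟙 (A ⊆? X))

    -- Condition on whether the first point belongs to the random set. If it does not, sets
    -- containing it can no longer be covered, and their coefficient becomes 0.
    in-branch out-branch : ∀ {P} → ℕ × Subset (suc P) → ℕ × Subset P
    in-branch  (c , _ ∷ A)       = c , A
    out-branch (c , inside  ∷ A) = 0 , A
    out-branch (c , outside ∷ A) = c , A

    -- The law of total expectation, scaled by a power of `L = 1 + l`: the first point is in with
    -- weight 1 and out with weight `l`.
    expected-split : ∀ {P} (F : Family (suc P)) →
                     expected F ≡ expected (List.map in-branch F) + l * expected (List.map out-branch F)
    expected-split F = trans (∑-cong F λ { (c , inside ∷ A)  → in-eq c (weight A) l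
                                         ; (c , outside ∷ A) → out-eq c (weight A) l })
      (trans (∑-+ F _ _) (cong₂ _+_ (sym (∑-map in-branch F _))
        (trans (∑-*ˡ l F _) (cong (l *_) (sym (∑-map out-branch F _))))))
      where
      in-eq : ∀ c w l → c * w ≡ c * w + l * 0
      in-eq = solve-∀
      out-eq : ∀ c w l → c * (w + l * w) ≡ c * w + l * (c * w)
      out-eq = solve-∀

    covered-in : ∀ {P} (X : Subset P) (F : Family (suc P)) → covered (inside ∷ X) F ≡ covered X (List.map in-branch F)
    covered-in X F = trans (∑-cong F λ { (c , inside ∷ A) → refl ; (c , outside ∷ A) → refl }) (sym (∑-map in-branch F _))

    covered-out : ∀ {P} (X : Subset P) (F : Family (suc P)) → covered (outside ∷ X) F ≡ covered X (List.map out-branch F)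
    covered-out X F = trans (∑-cong F λ { (c , inside ∷ A) → *-zeroʳ c ; (c , outside ∷ A) → refl }) (sym (∑-map out-branch F _))

  -- The method of conditional expectations: if the inequality failed in both branches, the weighted
  -- sum of the two failures would contradict the hypothesis, so some branch keeps it.
  derandomise : ∀ {P} (F F′ : List (ℕ × Subset P)) →
                ∑ F (λ (c , A) → c * weight A) ≤ ∑ F′ (λ (c , A) → c * weight A) →
                ∃ λ X → ∑ F (λ (c , A) → c * 𝟙 (A ⊆? X)) ≤ ∑ F′ (λ (c , A) → c * 𝟙 (A ⊆? X))
  derandomise {zero} F F′ le = [] , subst₂ _≤_ (empty F) (empty F′) le
    where
    empty : ∀ F → expected F ≡ covered [] F
    empty F = ∑-cong F λ { (c , []) → refl }
  derandomise {suc P} F F′ le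
    with expected (List.map in-branch F) ≤? expected (List.map in-branch F′)
       | expected (List.map out-branch F) ≤? expected (List.map out-branch F′)
  ... | yes le₁ | _ = let X , h = derandomise (List.map in-branch F) (List.map in-branch F′) le₁
                      in inside ∷ X , subst₂ _≤_ (sym (covered-in X F)) (sym (covered-in X F′)) h
  ... | no _ | yes le₀ = let X , h = derandomise (List.map out-branch F) (List.map out-branch F′) le₀
                         in outside ∷ X , subst₂ _≤_ (sym (covered-out X F)) (sym (covered-out X F′)) h
  ... | no gt₁ | no gt₀ = contradiction (subst₂ _≤_ (expected-split F) (expected-split F′) le)
                            (<⇒≱ (+-mono-<-≤ (≰⇒> gt₁) (*-monoʳ-≤ l (<⇒≤ (≰⇒> gt₀)))))

-- Counting k-subsets

ksubsets : (n k : ℕ) → List (Subset n)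
ksubsets zero    zero    = [] ∷ []
ksubsets zero    (suc k) = []
ksubsets (suc n) zero    = List.map (outside ∷_) (ksubsets n zero)
ksubsets (suc n) (suc k) = List.map (outside ∷_) (ksubsets n (suc k)) ++ List.map (inside ∷_) (ksubsets n k)

ksubsets-uniform : ∀ n k → All (λ e → ∣ e ∣ ≡ k) (ksubsets n k)
ksubsets-uniform zero    zero    = refl ∷ []
ksubsets-uniform zero    (suc k) = []
ksubsets-uniform (suc n) zero    = AllP.map⁺ (ksubsets-uniform n zero)
ksubsets-uniform (suc n) (suc k) = AllP.++⁺ (AllP.map⁺ (ksubsets-uniform n (suc k)))
                                            (AllP.map⁺ (All.map (cong suc) (ksubsets-uniform n k)))

ksubsets-unique : ∀ n k → Unique (ksubsets n k)
ksubsets-unique zero    zero    = [] ∷ []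
ksubsets-unique zero    (suc k) = []
ksubsets-unique (suc n) zero    = Uniq.map⁺ ∷-injectiveʳ (ksubsets-unique n zero)
ksubsets-unique (suc n) (suc k) = Uniq.++⁺ (Uniq.map⁺ ∷-injectiveʳ (ksubsets-unique n (suc k)))
                                           (Uniq.map⁺ ∷-injectiveʳ (ksubsets-unique n k)) disjoint
  where
  disjoint : ∀ {e} → ¬ (e ∈ₗ List.map (outside ∷_) (ksubsets n (suc k)) × e ∈ₗ List.map (inside ∷_) (ksubsets n k))
  disjoint (out , inn) with ∈-map⁻ (outside ∷_) out | ∈-map⁻ (inside ∷_) inn
  ... | _ , _ , refl | _ , _ , ()

length-ksubsets-suc : ∀ n k → length (ksubsets (suc n) (suc k)) ≡ length (ksubsets n (suc k)) + length (ksubsets n k)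
length-ksubsets-suc n k = trans (length-++ (List.map (outside ∷_) (ksubsets n (suc k))))
  (cong₂ _+_ (length-map (outside ∷_) (ksubsets n (suc k))) (length-map (inside ∷_) (ksubsets n k)))

-- The mean value estimate for the power `suc n`, in the shape that fits Pascal's rule below.
[1+m]^[1+n]≤ : ∀ m n → suc m ^ suc n ≤ m ^ suc n + suc n * suc m ^ n
[1+m]^[1+n]≤ m zero    = ≤-reflexive (trans (*-identityʳ (suc m)) (trans (+-comm 1 m) (cong (_+ 1) (sym (*-identityʳ m)))))
[1+m]^[1+n]≤ m (suc n) = begin
  S + m * S                                ≤⟨ +-monoʳ-≤ S (*-monoʳ-≤ m ([1+m]^[1+n]≤ m n)) ⟩
  S + m * (m ^ suc n + suc n * suc m ^ n)  ≡⟨ e₁ S m (m ^ suc n) (suc n) (suc m ^ n) ⟩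
  m * m ^ suc n + (S + suc n * (m * suc m ^ n))  ≤⟨ +-monoʳ-≤ (m * m ^ suc n) (+-monoʳ-≤ S (*-monoʳ-≤ (suc n) (*-monoˡ-≤ (suc m ^ n) (n≤1+n m)))) ⟩
  m * m ^ suc n + suc (suc n) * S          ∎
  where
  open ≤-Reasoning
  S = suc m ^ suc n
  e₁ : ∀ S m a c b → S + m * (a + c * b) ≡ m * a + (S + c * (m * b))
  e₁ = solve-∀

-- Induction along Pascal's rule: the increment from `a` to `suc a` is paid for by the `k`-subsets
-- that join the new point.
^≤!*ksubsets : ∀ a k → a ^ k ≤ k ! * length (ksubsets (a + k) k)
^≤!*ksubsets a zero = ≤-trans (positive (a + 0)) (≤-reflexive (sym (*-identityˡ _)))
  where
  positive : ∀ n → 1 ≤ length (ksubsets n 0)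
  positive zero    = ≤-refl
  positive (suc n) = ≤-trans (positive n) (≤-reflexive (sym (length-map (outside ∷_) (ksubsets n 0))))
^≤!*ksubsets zero (suc k) = z≤n
^≤!*ksubsets (suc a) (suc k) = begin
  suc a ^ suc k                                            ≤⟨ [1+m]^[1+n]≤ a k ⟩
  a ^ suc k + suc k * suc a ^ k                            ≤⟨ +-mono-≤ (^≤!*ksubsets a (suc k)) (*-monoʳ-≤ (suc k) (^≤!*ksubsets (suc a) k)) ⟩
  suc k ! * length (ksubsets (a + suc k) (suc k)) + suc k * (k ! * length (ksubsets (suc a + k) k))
    ≡⟨ cong₂ _+_ refl (sym (*-assoc (suc k) (k !) _)) ⟩
  suc k ! * length (ksubsets (a + suc k) (suc k)) + suc k ! * length (ksubsets (suc a + k) k)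
    ≡⟨ *-distribˡ-+ (suc k !) (length (ksubsets (a + suc k) (suc k))) (length (ksubsets (suc a + k) k)) ⟨
  suc k ! * (length (ksubsets (a + suc k) (suc k)) + length (ksubsets (suc a + k) k))
    ≡⟨ cong (λ n → suc k ! * (length (ksubsets (a + suc k) (suc k)) + length (ksubsets n k))) (+-suc a k) ⟨
  suc k ! * (length (ksubsets (a + suc k) (suc k)) + length (ksubsets (a + suc k) k))
    ≡⟨ cong (suc k ! *_) (length-ksubsets-suc (a + suc k) k) ⟨
  suc k ! * length (ksubsets (suc (a + suc k)) (suc k))    ∎
  where open ≤-Reasoning

n^k≤*ksubsets : ∀ n k → 2 * k ≤ n → n ^ k ≤ 2 ^ k * k ! * length (ksubsets n k)
n^k≤*ksubsets n k 2k≤n = begin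
  n ^ k                                       ≤⟨ ^-monoˡ-≤ k n≤2a ⟩
  (2 * a) ^ k                                 ≡⟨ ^-distribʳ-* 2 a k ⟩
  2 ^ k * a ^ k                               ≤⟨ *-monoʳ-≤ (2 ^ k) (^≤!*ksubsets a k) ⟩
  2 ^ k * (k ! * length (ksubsets (a + k) k)) ≡⟨ cong (λ n → 2 ^ k * (k ! * length (ksubsets n k))) a+k≡n ⟩
  2 ^ k * (k ! * length (ksubsets n k))       ≡⟨ *-assoc (2 ^ k) (k !) _ ⟨
  2 ^ k * k ! * length (ksubsets n k)         ∎
  where
  open ≤-Reasoning
  a = n ∸ k
  a+k≡n : a + k ≡ n
  a+k≡n = m∸n+n≡m (≤-trans (m≤m+n k (k + 0)) 2k≤n)
  k≤a : k ≤ a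
  k≤a = +-cancelʳ-≤ k k a (≤-trans (≤-reflexive (cong (k +_) (sym (+-identityʳ k)))) (≤-trans 2k≤n (≤-reflexive (sym a+k≡n))))
  n≤2a : n ≤ 2 * a
  n≤2a = ≤-trans (≤-reflexive (sym a+k≡n)) (+-monoʳ-≤ a (≤-trans k≤a (m≤m+n a 0)))

-- Reindexing and coding of finite subsets

∑-enumerate : ∀ {n} (S : Subset n) (g : Fin n → ℕ) →
              ∑ (allFin n) (λ u → if lookup S u then g u else 0) ≡ ∑ (allFin ∣ S ∣) (λ a → g (lookup (enumerate S) a))
∑-enumerate [] g = refl
∑-enumerate {suc n} (s ∷ S) g = trans (cong ((if s then g zero else 0) +_) tail) (split s)
  where
  allFin-suc : ∀ n → List.tabulate {A = Fin (suc n)} suc ≡ List.map suc (allFin n)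
  allFin-suc n = sym (List.map-tabulate id suc)
  tail : ∑ (List.tabulate suc) (λ u → if lookup (s ∷ S) u then g u else 0) ≡ ∑ (allFin ∣ S ∣) (λ a → g (suc (lookup (enumerate S) a)))
  tail = trans (cong (λ us → ∑ us (λ u → if lookup (s ∷ S) u then g u else 0)) (allFin-suc n))
    (trans (∑-map suc (allFin n) _) (∑-enumerate S (g ∘ suc)))
  shift : ∀ (as : List (Fin ∣ S ∣)) → ∑ as (λ a → g (suc (lookup (enumerate S) a))) ≡ ∑ as (λ a → g (lookup (Vec.map suc (enumerate S)) a))
  shift as = ∑-cong as (λ a → cong g (sym (Vec.lookup-map a suc (enumerate S))))
  split : ∀ s → (if s then g zero else 0) + ∑ (allFin ∣ S ∣) (λ a → g (suc (lookup (enumerate S) a))) ≡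
                ∑ (allFin ∣ s ∷ S ∣) (λ a → g (lookup (enumerate (s ∷ S)) a))
  split inside  = cong (g zero +_) (trans (shift (allFin ∣ S ∣))
    (sym (trans (cong (λ as → ∑ as (λ a → g (lookup (enumerate (inside ∷ S)) a))) (allFin-suc ∣ S ∣)) (∑-map suc (allFin ∣ S ∣) _))))
  split outside = shift (allFin ∣ S ∣)

enumerate-injective : ∀ {n} (S : Subset n) {a b} → lookup (enumerate S) a ≡ lookup (enumerate S) b → a ≡ b
enumerate-injective (inside ∷ S) {zero}  {zero}  eq = refl
enumerate-injective (inside ∷ S) {zero}  {suc b} eq = contradiction (trans eq (Vec.lookup-map b suc (enumerate S))) λ ()
enumerate-injective (inside ∷ S) {suc a} {zero}  eq = contradiction (trans (sym eq) (Vec.lookup-map a suc (enumerate S))) λ ()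
enumerate-injective (inside ∷ S) {suc a} {suc b} eq = cong suc (enumerate-injective S (Fin.suc-injective
  (trans (sym (Vec.lookup-map a suc (enumerate S))) (trans eq (Vec.lookup-map b suc (enumerate S))))))
enumerate-injective (outside ∷ S) {a} {b} eq = enumerate-injective S (Fin.suc-injective
  (trans (sym (Vec.lookup-map a suc (enumerate S))) (trans eq (Vec.lookup-map b suc (enumerate S)))))

module _ {P : ℕ} {C : Fin P → Set} (C? : ∀ c → Dec (C c)) where

  ⟨_⟩ : Subset P
  ⟨_⟩ = tabulate (does ∘ C?)

  ∈⟨⟩⁺ : ∀ {c} → C c → c ∈ ⟨_⟩
  ∈⟨⟩⁺ {c} Cc = lookup⇒[]= c ⟨_⟩ (trans (lookup∘tabulate (does ∘ C?) c) (dec-true (C? c) Cc))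

  ∈⟨⟩⁻ : ∀ {c} → c ∈ ⟨_⟩ → C c
  ∈⟨⟩⁻ {c} c∈ with C? c | trans (sym (lookup∘tabulate (does ∘ C?) c)) ([]=⇒lookup c∈)
  ... | yes Cc | _ = Cc

  ∣⟨⟩∣ : ∣ ⟨_⟩ ∣ ≡ ∑ (allFin P) (λ c → 𝟙 (C? c))
  ∣⟨⟩∣ = count id
    where
    count : ∀ {p} (g : Fin p → Fin P) → ∣ tabulate (does ∘ C? ∘ g) ∣ ≡ ∑ (List.tabulate g) (λ c → 𝟙 (C? c))
    count {zero}  g = refl
    count {suc p} g with does (C? (g zero))
    ... | true  = cong suc (count (g ∘ suc))
    ... | false = count (g ∘ suc)

length-cartesianProduct : {A B : Set} (xs : List A) (ys : List B) → length (cartesianProduct xs ys) ≡ length xs * length ys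
length-cartesianProduct []       ys = refl
length-cartesianProduct (x ∷ xs) ys = trans (length-++ (List.map (x ,_) ys))
  (cong₂ _+_ (length-map (x ,_) ys) (length-cartesianProduct xs ys))

∑-cartesianProduct : {A B : Set} (xs : List A) (ys : List B) (f : A × B → ℕ) →
                     ∑ (cartesianProduct xs ys) f ≡ ∑ xs (λ x → ∑ ys (λ y → f (x , y)))
∑-cartesianProduct []       ys f = refl
∑-cartesianProduct (x ∷ xs) ys f = trans (∑-++ (List.map (x ,_) ys) (cartesianProduct xs ys) f)
  (cong₂ _+_ (∑-map (x ,_) ys f) (∑-cartesianProduct xs ys f))

-- Random relations, k-sets and copies of the core

module _ {n : ℕ} where

  -- Binary relations on Fin n are coded as subsets of Fin (n * n).
  Square : Subset n → Fin (n * n) → Set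
  Square e c = proj₁ (remQuot {n} n c) ∈ e × proj₂ (remQuot {n} n c) ∈ e

  square? : ∀ e c → Dec (Square e c)
  square? e c = (proj₁ (remQuot {n} n c) Sub.∈? e) ×-dec (proj₂ (remQuot {n} n c) Sub.∈? e)

  square : Subset n → Subset (n * n)
  square e = ⟨ square? e ⟩

  ∈-square : ∀ {e x y} → x ∈ e → y ∈ e → combine x y ∈ square e
  ∈-square {e} {x} {y} x∈ y∈ = ∈⟨⟩⁺ (square? e) (subst (λ (x , y) → x ∈ e × y ∈ e) (sym (Fin.remQuot-combine x y)) (x∈ , y∈))

  ∣square∣≤ : ∀ e → ∣ square e ∣ ≤ ∣ e ∣ * ∣ e ∣
  ∣square∣≤ e = begin
    ∣ square e ∣                                    ≡⟨ ∣⟨⟩∣ (square? e) ⟩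
    ∑ (allFin (n * n)) (λ c → 𝟙 (square? e c))      ≤⟨ ∑𝟙≤length Fin._≟_ (square? e) {xs = codes} (Uniq.allFin⁺ (n * n)) code ⟩
    length codes                                    ≡⟨ length-map (uncurry combine) (cartesianProduct es es) ⟩
    length (cartesianProduct es es)                 ≡⟨ length-cartesianProduct es es ⟩
    length es * length es                           ≡⟨ cong (λ l → l * l) (Vec.length-toList (enumerate e)) ⟩
    ∣ e ∣ * ∣ e ∣                                   ∎
    where
    open ≤-Reasoning
    es = toList (enumerate e)
    codes = List.map (uncurry combine) (cartesianProduct es es)
    code : ∀ {c} → Square e c → c ∈ₗ codes
    code {c} (x∈ , y∈) = subst (_∈ₗ codes) (Fin.combine-remQuot {n} n c)
      (∈-map⁺ (uncurry combine) (∈-cartesianProduct⁺ (∈-toList⁺ (∈-enumerate⁺ x∈)) (∈-toList⁺ (∈-enumerate⁺ y∈))))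

  module Copies {s : ℕ} (F : Fin s → Fin s → Bool) (d : ℕ) (d≤deg : ∀ b → d ≤ ∑ (allFin s) (λ a → if F a b then 1 else 0)) where

    F? : (p : Fin s × Fin s) → Dec (uncurry F p ≡ true)
    F? p = uncurry F p Bool.≟ true

    pairs : List (Fin s × Fin s)
    pairs = filter F? (cartesianProduct (allFin s) (allFin s))

    codes : Vec (Fin n) s → List (Fin (n * n))
    codes y = List.map (λ (a , b) → combine (lookup y a) (lookup y b)) pairs

    copy? : ∀ y c → Dec (c ∈ₗ codes y)
    copy? y c = DecMem._∈?_ Fin._≟_ c (codes y)

    copy : Vec (Fin n) s → Subset (n * n)
    copy y = ⟨ copy? y ⟩

    -- Ordered pairs are counted, so summing the degrees gives `d * s` without halving.
    ds≤pairs : d * s ≤ length pairs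
    ds≤pairs = begin
      d * s                                                                  ≡⟨ *-comm d s ⟩
      s * d                                                                  ≡⟨ cong (_* d) (length-tabulate {n = s} id) ⟨
      length (allFin s) * d                                                  ≡⟨ ∑-const (allFin s) d ⟨
      ∑ (allFin s) (λ _ → d)                                                 ≤⟨ ∑-mono (allFin s) (λ b _ → d≤deg b) ⟩
      ∑ (allFin s) (λ b → ∑ (allFin s) (λ a → if F a b then 1 else 0))       ≡⟨ ∑-swap (allFin s) (allFin s) _ ⟩
      ∑ (allFin s) (λ a → ∑ (allFin s) (λ b → if F a b then 1 else 0))       ≡⟨ ∑-cong (allFin s) (λ a → ∑-cong (allFin s) (λ b → same (F a b))) ⟩
      ∑ (allFin s) (λ a → ∑ (allFin s) (λ b → 𝟙 (F a b Bool.≟ true)))        ≡⟨ ∑-cartesianProduct (allFin s) (allFin s) (𝟙 ∘ F?) ⟨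
      ∑ (cartesianProduct (allFin s) (allFin s)) (𝟙 ∘ F?)                    ≡⟨ ∑-filter F? (cartesianProduct (allFin s) (allFin s)) ⟨
      length pairs                                                           ∎
      where
      open ≤-Reasoning
      same : ∀ b → (if b then 1 else 0) ≡ 𝟙 (b Bool.≟ true)
      same true  = refl
      same false = refl

    Inj : Vec (Fin n) s → Set
    Inj y = ∀ a b → lookup y a ≡ lookup y b → a ≡ b

    inj? : ∀ y → Dec (Inj y)
    inj? y = Fin.all? λ a → Fin.all? λ b → (lookup y a Fin.≟ lookup y b) →-dec (a Fin.≟ b)

    ds≤∣copy∣ : ∀ y → Inj y → d * s ≤ ∣ copy y ∣
    ds≤∣copy∣ y inj = begin
      d * s                                            ≤⟨ ds≤pairs ⟩
      length pairs                                     ≡⟨ length-map _ pairs ⟨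
      length (codes y)                                 ≤⟨ length≤∑𝟙 Fin._≟_ (copy? y) unique (λ c∈ → ∈-allFin _ , c∈) ⟩
      ∑ (allFin (n * n)) (λ c → 𝟙 (copy? y c))         ≡⟨ ∣⟨⟩∣ (copy? y) ⟨
      ∣ copy y ∣                                       ∎
      where
      open ≤-Reasoning
      unique : Unique (codes y)
      unique = Uniq.map⁺ (λ {(a , b)} {(a′ , b′)} eq → cong₂ _,_
        (inj a a′ (Fin.combine-injectiveˡ (lookup y a) (lookup y b) (lookup y a′) (lookup y b′) eq))
        (inj b b′ (Fin.combine-injectiveʳ (lookup y a) (lookup y b) (lookup y a′) (lookup y b′) eq)))
        (Uniq.filter⁺ F? (Uniq.cartesianProduct⁺ (Uniq.allFin⁺ s) (Uniq.allFin⁺ s)))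

    copy⊆ : ∀ y (X : Subset (n * n)) → (∀ a b → F a b ≡ true → combine (lookup y a) (lookup y b) ∈ X) → copy y ⊆ X
    copy⊆ y X h c∈ with ∈-map⁻ _ (∈⟨⟩⁻ (copy? y) c∈)
    ... | (a , b) , p∈ , refl = h a b (∈-filter⁻ F? {xs = cartesianProduct (allFin s) (allFin s)} p∈ .proj₂)

    module Alteration (k l T : ℕ) (1≤T : 1 ≤ T) (1≤s : 1 ≤ s) (1≤n : 1 ≤ n)
                      (few : 2 * (T * suc l ^ (k * k)) ≤ length (ksubsets n k))
                      (n²≤L^d : n ^ 2 ≤ suc l ^ d) (2L^≤n : 2 * suc l ^ (k * k) ≤ n) where
      open Derandomise l

      private
        M Y Λ W : ℕ
        M = length (ksubsets n k)
        Y = L ^ (k * k)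
        Λ = L ^ (n * n)
        ys : List (Vec (Fin n) s)
        ys = filter inj? (tuples (allFin n) s)
        W = ∑ ys (λ y → weight (copy y))
        F₀ F₁ : List (ℕ × Subset (n * n))
        F₁ = List.map (λ e → 1 , square e) (ksubsets n k)
        -- `⊥` lies in every `X` and contributes the constant `T`. A copy is charged `M`, the number
        -- of all `k`-sets, so that a single surviving copy is already too expensive.
        F₀ = (T , ⊥) ∷ List.map (λ y → M , copy y) ys
        instance
          n≢0 : NonZero n
          n≢0 = >-nonZero 1≤n
          n^s≢0 : NonZero (n ^ s)
          n^s≢0 = m^n≢0 n s
          Y≢0 : NonZero (2 * Y)
          Y≢0 = m*n≢0 2 Y {{_}} {{m^n≢0 L (k * k)}}

      -- A `k`-set needs at most `k * k` pairs, so each of the `M` sets keeps a proportion of at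
      -- least `1 / Y`.
      edges-weight : M * Λ ≤ ∑ (ksubsets n k) (λ e → weight (square e)) * Y
      edges-weight = begin
        M * Λ                                                  ≡⟨ ∑-const (ksubsets n k) Λ ⟨
        ∑ (ksubsets n k) (λ _ → Λ)                             ≤⟨ ∑-mono (ksubsets n k) bound ⟩
        ∑ (ksubsets n k) (λ e → weight (square e) * Y)         ≡⟨ ∑-*ʳ Y (ksubsets n k) _ ⟩
        ∑ (ksubsets n k) (λ e → weight (square e)) * Y         ∎
        where
        open ≤-Reasoning
        bound : ∀ e → e ∈ₗ ksubsets n k → Λ ≤ weight (square e) * Y
        bound e e∈ = begin
          Λ                                          ≡⟨ weight-∣∣ (square e) ⟨
          weight (square e) * L ^ ∣ square e ∣       ≤⟨ *-monoʳ-≤ (weight (square e)) (^-monoʳ-≤ L (∣square∣≤ e)) ⟩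
          weight (square e) * L ^ (∣ e ∣ * ∣ e ∣)    ≡⟨ cong (λ u → weight (square e) * L ^ (u * u)) (All.lookup (ksubsets-uniform n k) e∈) ⟩
          weight (square e) * Y                      ∎

      -- There are at most `n ^ s` placements, each of weight at most `Λ / L ^ (d * s)`, hence at
      -- most `Λ / n ^ (2 * s)`. Their total is at most `Λ / n ^ s`, and `n ^ s ≥ n ≥ 2 * Y`.
      copies-weight : W * (2 * Y) ≤ Λ
      copies-weight = ≤-trans (*-monoʳ-≤ W (≤-trans 2L^≤n (≤-trans (≤-reflexive (sym (*-identityʳ n))) (^-monoʳ-≤ n 1≤s))))
        (*-cancelʳ-≤ (W * n ^ s) Λ (n ^ s) (begin
        W * n ^ s * n ^ s                           ≡⟨ *-assoc W (n ^ s) (n ^ s) ⟩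
        W * (n ^ s * n ^ s)                         ≡⟨ ∑-*ʳ (n ^ s * n ^ s) ys _ ⟨
        ∑ ys (λ y → weight (copy y) * (n ^ s * n ^ s)) ≤⟨ ∑-mono ys bound ⟩
        ∑ ys (λ _ → Λ)                              ≡⟨ ∑-const ys Λ ⟩
        length ys * Λ                               ≤⟨ *-monoˡ-≤ Λ (length-filter inj? (tuples (allFin n) s)) ⟩
        length (tuples (allFin n) s) * Λ            ≡⟨ cong (_* Λ) (trans (length-tuples (allFin n) s) (cong (_^ s) (length-tabulate {n = n} id))) ⟩
        n ^ s * Λ                                   ≡⟨ *-comm (n ^ s) Λ ⟩
        Λ * n ^ s                                   ∎))
        where
        open ≤-Reasoning
        n^s² : n ^ s * n ^ s ≤ L ^ (d * s)
        n^s² = begin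
          n ^ s * n ^ s     ≡⟨ ^-distribʳ-* n n s ⟨
          (n * n) ^ s       ≡⟨ cong (λ e → (n * e) ^ s) (*-identityʳ n) ⟨
          (n ^ 2) ^ s       ≤⟨ ^-monoˡ-≤ s n²≤L^d ⟩
          (L ^ d) ^ s       ≡⟨ ^-*-assoc L d s ⟩
          L ^ (d * s)       ∎
        bound : ∀ y → y ∈ₗ ys → weight (copy y) * (n ^ s * n ^ s) ≤ Λ
        bound y y∈ = begin
          weight (copy y) * (n ^ s * n ^ s)     ≤⟨ *-monoʳ-≤ (weight (copy y)) n^s² ⟩
          weight (copy y) * L ^ (d * s)         ≤⟨ *-monoʳ-≤ (weight (copy y)) (^-monoʳ-≤ L (ds≤∣copy∣ y
                                                     (∈-filter⁻ inj? {xs = tuples (allFin n) s} y∈ .proj₂))) ⟩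
          weight (copy y) * L ^ ∣ copy y ∣      ≡⟨ weight-∣∣ (copy y) ⟩
          Λ                                     ∎

      -- After multiplication by `2 * Y`, the target `T` and the charge for copies each take at most
      -- `M * Λ`, and the `k`-sets provide twice that.
      F₀≤F₁ : ∑ F₀ (λ (c , A) → c * weight A) ≤ ∑ F₁ (λ (c , A) → c * weight A)
      F₀≤F₁ = *-cancelʳ-≤ _ _ (2 * Y) (begin
        (T * weight (⊥ {n * n}) + ∑ (List.map (λ y → M , copy y) ys) (λ (c , A) → c * weight A)) * (2 * Y)
          ≡⟨ cong₂ (λ u v → (T * u + v) * (2 * Y)) weight-⊥ (trans (∑-map (λ y → M , copy y) ys _) (∑-*ˡ M ys _)) ⟩
        (T * Λ + M * W) * (2 * Y)                  ≡⟨ e₁ T Λ M W Y ⟩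
        2 * (T * Y) * Λ + M * (W * (2 * Y))        ≤⟨ +-mono-≤ (*-monoˡ-≤ Λ few) (*-monoʳ-≤ M copies-weight) ⟩
        M * Λ + M * Λ                              ≤⟨ +-mono-≤ edges-weight edges-weight ⟩
        A * Y + A * Y                              ≡⟨ e₂ A Y ⟩
        A * (2 * Y)                                ≡⟨ cong (_* (2 * Y)) (trans (∑-map (λ e → 1 , square e) (ksubsets n k) _)
                                                        (∑-cong (ksubsets n k) (λ e → *-identityˡ (weight (square e))))) ⟨
        ∑ F₁ (λ (c , A) → c * weight A) * (2 * Y)  ∎)
        where
        open ≤-Reasoning
        A = ∑ (ksubsets n k) (λ e → weight (square e))
        weight-⊥ : weight (⊥ {n * n}) ≡ Λ
        weight-⊥ = trans (sym (*-identityʳ _)) (trans (cong (λ u → weight (⊥ {n * n}) * L ^ u) (sym (∣⊥∣≡0 (n * n)))) (weight-∣∣ (⊥ {n * n})))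
        e₁ : ∀ T Λ M W Y → (T * Λ + M * W) * (2 * Y) ≡ 2 * (T * Y) * Λ + M * (W * (2 * Y))
        e₁ = solve-∀
        e₂ : ∀ A Y → A * Y + A * Y ≡ A * (2 * Y)
        e₂ = solve-∀

      X : Subset (n * n)
      X = derandomise F₀ F₁ F₀≤F₁ .proj₁

      G : Hypergraph k n
      G = record
        { edges    = filter (λ e → square e ⊆? X) (ksubsets n k)
        ; uniform  = AllP.filter⁺ (λ e → square e ⊆? X) (ksubsets-uniform n k)
        ; distinct = Uniq.filter⁺ (λ e → square e ⊆? X) (ksubsets-unique n k)
        }

      square⊆X : ∀ {e} → e ∈ₗ edges G → square e ⊆ X
      square⊆X e∈ = ∈-filter⁻ (λ e → square e ⊆? X) {xs = ksubsets n k} e∈ .proj₂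

      T+copies≤edges : T + M * ∑ ys (λ y → 𝟙 (copy y ⊆? X)) ≤ e[ G ]
      T+copies≤edges = begin
        T + M * ∑ ys (λ y → 𝟙 (copy y ⊆? X))
          ≡⟨ cong₂ _+_ (trans (sym (*-identityʳ T)) (cong (T *_) (sym (𝟙-yes (⊥ ⊆? X) (λ c∈ → contradiction c∈ Sub.∉⊥)))))
                       (trans (sym (∑-*ˡ M ys _)) (sym (∑-map (λ y → M , copy y) ys _))) ⟩
        ∑ F₀ (λ (c , A) → c * 𝟙 (A ⊆? X))                  ≤⟨ derandomise F₀ F₁ F₀≤F₁ .proj₂ ⟩
        ∑ F₁ (λ (c , A) → c * 𝟙 (A ⊆? X))                  ≡⟨ ∑-map (λ e → 1 , square e) (ksubsets n k) _ ⟩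
        ∑ (ksubsets n k) (λ e → 1 * 𝟙 (square e ⊆? X))     ≡⟨ ∑-cong (ksubsets n k) (λ e → *-identityˡ _) ⟩
        ∑ (ksubsets n k) (λ e → 𝟙 (square e ⊆? X))         ≡⟨ ∑-filter (λ e → square e ⊆? X) (ksubsets n k) ⟨
        e[ G ]                                             ∎
        where open ≤-Reasoning

      T≤edges : T ≤ e[ G ]
      T≤edges = ≤-trans (m≤m+n T _) T+copies≤edges

      -- A copy inside `X` would force `T + M` edges, but there are only `M` candidate `k`-sets and
      -- `T ≥ 1`.
      copy-free : ∀ y → Inj y → ¬ (copy y ⊆ X)
      copy-free y inj c⊆X = <⇒≱ (begin-strict
        M                                              <⟨ m<n+m M 1≤T ⟩
        T + M                                          ≡⟨ cong (T +_) (*-identityʳ M) ⟨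
        T + M * 1                                      ≤⟨ +-monoʳ-≤ T (*-monoʳ-≤ M hit) ⟩
        T + M * ∑ ys (λ y → 𝟙 (copy y ⊆? X))           ≤⟨ T+copies≤edges ⟩
        e[ G ]                                         ∎)
        (length-filter (λ e → square e ⊆? X) (ksubsets n k))
        where
        open ≤-Reasoning
        hit : 1 ≤ ∑ ys (λ y → 𝟙 (copy y ⊆? X))
        hit = ≤-trans (≤-reflexive (sym (𝟙-yes (copy y ⊆? X) c⊆X)))
          (∑-∈ (λ y → 𝟙 (copy y ⊆? X)) (∈-filter⁺ inj? (∈-tuples y (λ a → ∈-allFin (lookup y a))) inj))

      no-copy : ∀ y → Inj y → ¬ (∀ a b → F a b ≡ true → ∃ λ e → e ∈ₗ edges G × lookup y a ∈ e × lookup y b ∈ e)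
      no-copy y inj joined = copy-free y inj (copy⊆ y X λ a b Fab →
        let e , e∈ , a∈e , b∈e = joined a b Fab in square⊆X e∈ (∈-square a∈e b∈e))

-- The lower bound

any-true⁻ : {A : Set} (p : A → Bool) {xs : List A} → any p xs ≡ true → ∃ λ x → x ∈ₗ xs × p x ≡ true
any-true⁻ p {x ∷ xs} eq with p x in px
... | true  = x , here refl , px
... | false = let y , y∈ , py = any-true⁻ p eq in y , there y∈ , py

adjacent⁻ : ∀ {k m} (H : Hypergraph k m) {u v} → adj₁ H u v ≡ true → ∃ λ e → e ∈ₗ edges H × u ∈ e × v ∈ e
adjacent⁻ H {u} {v} adj with u Fin.≟ v
... | no _ = let e , e∈ , both = any-true⁻ _ adj in
  e , e∈ , lookup⇒[]= u e (Bool.∧-conicalˡ (lookup e u) _ both) , lookup⇒[]= v e (Bool.∧-conicalʳ (lookup e u) _ both)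

-- If no such `S` existed, every nonempty set would have a vertex of degree below `d`, and the
-- degeneracy would be at most `d ∸ 1`, against minimality.
core : ∀ {k m} (H : Hypergraph k m) {d} → IsSkelDeg H d → 1 ≤ d →
       ∃ λ S → Nonempty S × (∀ v → v ∈ S → d ≤ deg₁ H S v)
core H {suc d} (_ , minimal) _ with anySubset? core?
  where
  core? : ∀ S → Dec (Nonempty S × (∀ v → v ∈ S → suc d ≤ deg₁ H S v))
  core? S = nonempty? S ×-dec Fin.all? (λ v → (v Sub.∈? S) →-dec (suc d ≤? deg₁ H S v))
... | yes p = p
... | no ¬p = contradiction (minimal d degenerate) (<⇒≱ ≤-refl)
  where
  degenerate : DegenerateBy₁ H d
  degenerate S ne with Fin.any? (λ v → (v Sub.∈? S) ×-dec (deg₁ H S v ≤? d))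
  ... | yes q = q
  ... | no ¬q = contradiction (S , ne , λ v v∈ → ≰⇒> λ le → ¬q (v , v∈ , le)) ¬p

-- The exponent is `k` times the threshold `4 * (k * k)`, so that smaller degeneracies are trivial.
-- The constant collects `2 ^ k * k !` from counting `k`-sets, 4 from rounding `T`, and
-- `2 ^ (k * k)` from rounding `L`.
lower-constant lower-exponent : ℕ → ℕ
lower-constant k = 4 * (2 ^ k * k !) * 2 ^ (k * k)
lower-exponent k = k * (4 * (k * k))

module Lower {k m : ℕ} (2≤k : 2 ≤ k) (H : Hypergraph k m) (2≤e : 2 ≤ e[ H ]) (d : ℕ) (skel : IsSkelDeg H d) where

  K β r N₀ : ℕ
  K  = 2 ^ k * k !
  β  = lower-constant k
  r  = lower-exponent k
  -- `2 * k` serves the count of `k`-sets, `K` the bound `2 * Y ≤ M`, and `2 ^ (4 + d)` the bound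
  -- `2 * Y ≤ n`.
  N₀ = 2 * k + K + 2 ^ (4 + d)

  1≤K : 1 ≤ K
  1≤K = *-mono-≤ (m^n>0 2 k) (1≤n! k)

  1≤k² : 1 ≤ k * k
  1≤k² = *-mono-≤ (≤-trans (n≤1+n 1) 2≤k) (≤-trans (n≤1+n 1) 2≤k)

  1≤β : 1 ≤ β
  1≤β = *-mono-≤ (*-mono-≤ (s≤s (z≤n {3})) 1≤K) (m^n>0 2 (k * k))

  module _ {n t : ℕ} (N₀≤n : N₀ ≤ n) (ex : IsEx n H t) where

    2k≤n : 2 * k ≤ n
    2k≤n = ≤-trans (≤-trans (m≤m+n (2 * k) K) (m≤m+n _ _)) N₀≤n

    K≤n : K ≤ n
    K≤n = ≤-trans (≤-trans (m≤n+m K (2 * k)) (m≤m+n _ _)) N₀≤n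

    2^[4+d]≤n : 2 ^ (4 + d) ≤ n
    2^[4+d]≤n = ≤-trans (m≤n+m _ (2 * k + K)) N₀≤n

    1≤n : 1 ≤ n
    1≤n = ≤-trans 1≤K K≤n

    M : ℕ
    M = length (ksubsets n k)

    n^k≤KM : n ^ k ≤ K * M
    n^k≤KM = n^k≤*ksubsets n k 2k≤n

    private instance
      n≢0 : NonZero n
      n≢0 = >-nonZero 1≤n
      K≢0 : NonZero K
      K≢0 = >-nonZero 1≤K

    1≤M : 1 ≤ M
    1≤M = *-cancelˡ-< K 0 M (subst (_< K * M) (sym (*-zeroʳ K)) (<-≤-trans (m^n>0 n k) n^k≤KM))

    -- A hypergraph with one edge is `H`-free: both of two distinct edges of `H` would map onto that
    -- edge, and injectivity would make them equal.
    1≤t : 1 ≤ t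
    1≤t = single (ksubsets n k) (ksubsets-uniform n k) 1≤M
      where
      single : ∀ es → All (λ e → ∣ e ∣ ≡ k) es → 1 ≤ length es → 1 ≤ t
      single (e ∷ _) (∣e∣≡k ∷ _) _ = ex .proj₂ G (free (edges H) 2≤e (distinct H) (λ _ e∈ → e∈))
        where
        G : Hypergraph k n
        G = record { edges = e ∷ [] ; uniform = ∣e∣≡k ∷ [] ; distinct = [] ∷ [] }
        free : ∀ es → 2 ≤ length es → Unique es → (∀ e → e ∈ₗ es → e ∈ₗ edges H) → HFree H G
        free (_ ∷ []) (s≤s ())
        free (e₁ ∷ e₂ ∷ _) _ ((e₁≢e₂ ∷ _) ∷ _) es⊆ (φ , φ-inj , edge) =
          e₁≢e₂ (⊆-antisym (transfer e₁∈ e₂∈) (transfer e₂∈ e₁∈))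
          where
          e₁∈ = es⊆ e₁ (here refl)
          e₂∈ = es⊆ e₂ (there (here refl))
          transfer : ∀ {f f′} → f ∈ₗ edges H → f′ ∈ₗ edges H → f ⊆ f′
          transfer {f} {f′} f∈ f′∈ {i} i∈f with edge f f∈ | edge f′ f′∈
          ... | _ , here refl , image | _ , here refl , image′
            with Equivalence.to (image′ (φ i)) (Equivalence.from (image (φ i)) (i , i∈f , refl))
          ...   | i′ , i′∈f′ , eq = subst (_∈ f′) (φ-inj eq) i′∈f′

    small-degeneracy : d ≤ 4 * (k * k) → n ^ (k * d) ≤ β ^ d * t ^ d * n ^ r
    small-degeneracy d≤ = begin
      n ^ (k * d)              ≤⟨ ^-monoʳ-≤ n (*-monoʳ-≤ k d≤) ⟩
      n ^ r                    ≡⟨ *-identityˡ (n ^ r) ⟨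
      1 * n ^ r                ≤⟨ *-monoˡ-≤ (n ^ r) (*-mono-≤ (m^n>0 β {{>-nonZero 1≤β}} d) (m^n>0 t {{>-nonZero 1≤t}} d)) ⟩
      β ^ d * t ^ d * n ^ r    ∎
      where open ≤-Reasoning

    module LargeDegeneracy (4k²≤d : 4 * (k * k) ≤ d) where
      open ≤-Reasoning

      1≤d : 1 ≤ d
      1≤d = ≤-trans (*-mono-≤ (s≤s (z≤n {3})) 1≤k²) 4k²≤d

      l L Y T : ℕ
      -- Rounding up, `L = suc l` is the least integer with `L ^ d > n ^ 2`; it exceeds the real
      -- root by at most a factor 2.
      l = root d 1≤d (n ^ 2) .proj₁
      L = suc l
      Y = L ^ (k * k)

      instance
        2Y≢0 : NonZero (2 * Y)
        2Y≢0 = m*n≢0 2 Y {{_}} {{m^n≢0 L (k * k)}}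

      -- The largest `T` that `few` allows; since it is at least 1, rounding down costs at most a
      -- factor 2.
      T = M / (2 * Y)

      n²≤L^d : n ^ 2 ≤ L ^ d
      n²≤L^d = <⇒≤ (root d 1≤d (n ^ 2) .proj₂ .proj₂)

      L^d≤ : L ^ d ≤ 2 ^ d * n ^ 2
      L^d≤ = begin
        L ^ d              ≤⟨ ^-monoˡ-≤ d L≤2l ⟩
        (2 * l) ^ d        ≡⟨ ^-distribʳ-* 2 l d ⟩
        2 ^ d * l ^ d      ≤⟨ *-monoʳ-≤ (2 ^ d) (root d 1≤d (n ^ 2) .proj₂ .proj₁) ⟩
        2 ^ d * n ^ 2      ∎
        where
        1≤l : 1 ≤ l
        1≤l = ≰⇒> λ l≤0 → <⇒≱ (root d 1≤d (n ^ 2) .proj₂ .proj₂)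
          (≤-trans (^-monoˡ-≤ d (s≤s l≤0)) (≤-trans (≤-reflexive (^-zeroˡ d)) (m^n>0 n 2)))
        L≤2l : L ≤ 2 * l
        L≤2l = ≤-trans (+-monoˡ-≤ l 1≤l) (≤-reflexive (cong (l +_) (sym (+-identityʳ l))))

      -- Compare fourth powers: `Y ^ 4` is `L ^ (4 * (k * k))`, at most `L ^ d` and so at most
      -- `2 ^ d * n ^ 2`. Here the threshold on `d` enters.
      2Y≤n : 2 * Y ≤ n
      2Y≤n = ^-cancelʳ-≤ 3 (begin
        (2 * Y) ^ 4                      ≡⟨ ^-distribʳ-* 2 Y 4 ⟩
        2 ^ 4 * Y ^ 4                    ≡⟨ cong (2 ^ 4 *_) (trans (^-*-assoc L (k * k) 4) (cong (L ^_) (*-comm (k * k) 4))) ⟩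
        2 ^ 4 * L ^ (4 * (k * k))        ≤⟨ *-monoʳ-≤ (2 ^ 4) (≤-trans (^-monoʳ-≤ L 4k²≤d) L^d≤) ⟩
        2 ^ 4 * (2 ^ d * n ^ 2)          ≡⟨ *-assoc (2 ^ 4) (2 ^ d) (n ^ 2) ⟨
        2 ^ 4 * 2 ^ d * n ^ 2            ≡⟨ cong (_* n ^ 2) (^-distribˡ-+-* 2 4 d) ⟨
        2 ^ (4 + d) * n ^ 2              ≤⟨ *-monoˡ-≤ (n ^ 2) (≤-trans 2^[4+d]≤n (m≤m*n n (n ^ 1) {{m^n≢0 n 1}})) ⟩
        n ^ 2 * n ^ 2                    ≡⟨ ^-distribˡ-+-* n 2 2 ⟨
        n ^ 4                            ∎)

      2Y≤M : 2 * Y ≤ M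
      2Y≤M = *-cancelˡ-≤ K (begin
        K * (2 * Y)   ≤⟨ *-mono-≤ K≤n 2Y≤n ⟩
        n * n         ≡⟨ cong (n *_) (*-identityʳ n) ⟨
        n ^ 2         ≤⟨ ^-monoʳ-≤ n 2≤k ⟩
        n ^ k         ≤⟨ n^k≤KM ⟩
        K * M         ∎)

      1≤T : 1 ≤ T
      1≤T = m≥n⇒m/n>0 2Y≤M

      few : 2 * (T * Y) ≤ M
      few = ≤-trans (≤-reflexive (shuffle T Y)) (m/n*n≤m M (2 * Y))
        where
        shuffle : ∀ a b → 2 * (a * b) ≡ a * (2 * b)
        shuffle = solve-∀

      M≤4TY : M ≤ 4 * T * Y
      M≤4TY = begin
        M                              ≡⟨ m≡m%n+[m/n]*n M (2 * Y) ⟩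
        M % (2 * Y) + T * (2 * Y)      ≤⟨ +-monoˡ-≤ (T * (2 * Y)) (<⇒≤ (m%n<n M (2 * Y))) ⟩
        2 * Y + T * (2 * Y)            ≤⟨ +-monoˡ-≤ (T * (2 * Y)) (m≤n*m (2 * Y) T {{>-nonZero 1≤T}}) ⟩
        T * (2 * Y) + T * (2 * Y)      ≡⟨ shuffle T Y ⟩
        4 * T * Y                      ∎
        where
        shuffle : ∀ a b → a * (2 * b) + a * (2 * b) ≡ 4 * a * b
        shuffle = solve-∀

      -- A copy of `H` in the constructed hypergraph would restrict to an injective placement of the
      -- core `S` whose adjacent pairs all lie in edges, which the alteration excludes.
      T≤t : T ≤ t
      T≤t = ≤-trans T≤edges (ex .proj₂ G free)
        where
        S = core H skel 1≤d .proj₁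
        φS : ∀ {n} → (Fin m → Fin n) → Vec (Fin n) ∣ S ∣
        φS φ = Vec.map φ (enumerate S)
        F : Fin ∣ S ∣ → Fin ∣ S ∣ → Bool
        F a b = adj₁ H (lookup (enumerate S) a) (lookup (enumerate S) b)
        d≤deg : ∀ b → d ≤ ∑ (allFin ∣ S ∣) (λ a → if F a b then 1 else 0)
        d≤deg b = begin
          d                                                          ≤⟨ core H skel 1≤d .proj₂ .proj₂ v (enumerate-∈ S b) ⟩
          deg₁ H S v                                                 ≡⟨ ∑-cong (allFin m) (λ u → nested (lookup S u) (adj₁ H u v)) ⟩
          ∑ (allFin m) (λ u → if lookup S u then (if adj₁ H u v then 1 else 0) else 0)
                                                                     ≡⟨ ∑-enumerate S (λ u → if adj₁ H u v then 1 else 0) ⟩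
          ∑ (allFin ∣ S ∣) (λ a → if F a b then 1 else 0)            ∎
          where
          v = lookup (enumerate S) b
          nested : ∀ x y → (if x ∧ y then 1 else 0) ≡ (if x then (if y then 1 else 0) else 0)
          nested true  y = refl
          nested false y = refl
        1≤∣S∣ : 1 ≤ ∣ S ∣
        1≤∣S∣ with core H skel 1≤d .proj₂ .proj₁
        ... | v , v∈S = ≤-trans (s≤s z≤n) (Sub.x∈p⇒∣p-x∣<∣p∣ v∈S)
        open Copies {n} F d d≤deg
        open Alteration k l T 1≤T 1≤∣S∣ 1≤n few n²≤L^d 2Y≤n
        free : HFree H G
        free (φ , φ-inj , edge) = no-copy (φS φ) inj λ a b adj →
          let e , e∈ , u∈e , v∈e = adjacent⁻ H adj
              e′ , e′∈G , image = edge e e∈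
          in e′ , e′∈G , Equivalence.from (image _) (_ , u∈e , sym (at a)) , Equivalence.from (image _) (_ , v∈e , sym (at b))
          where
          at : ∀ a → lookup (φS φ) a ≡ φ (lookup (enumerate S) a)
          at a = Vec.lookup-map a φ (enumerate S)
          inj : Inj (φS φ)
          inj a b eq = enumerate-injective S (φ-inj (trans (sym (at a)) (trans eq (at b))))

      -- Take `d`-th powers in `n ^ k ≤ K * (4 * T * Y)`. The loss `Y ^ d = (L ^ d) ^ (k * k)` costs
      -- `n ^ (2 * (k * k))` up to constants, and `2 * (k * k)` is at most `r`.
      large-degeneracy : n ^ (k * d) ≤ β ^ d * t ^ d * n ^ r
      large-degeneracy = begin
        n ^ (k * d)                                   ≡⟨ ^-*-assoc n k d ⟨
        (n ^ k) ^ d                                   ≤⟨ ^-monoˡ-≤ d (≤-trans n^k≤KM (*-monoʳ-≤ K M≤4TY)) ⟩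
        (K * (4 * T * Y)) ^ d                         ≡⟨ cong (_^ d) (shuffle K T Y) ⟩
        (4 * K * T * Y) ^ d                           ≡⟨ ^-distribʳ-* (4 * K * T) Y d ⟩
        (4 * K * T) ^ d * Y ^ d                       ≤⟨ *-mono-≤ (^-monoˡ-≤ d (*-monoʳ-≤ (4 * K) T≤t)) Y^d≤ ⟩
        (4 * K * t) ^ d * ((2 ^ (k * k)) ^ d * n ^ r) ≡⟨ cong (_* ((2 ^ (k * k)) ^ d * n ^ r)) (^-distribʳ-* (4 * K) t d) ⟩
        (4 * K) ^ d * t ^ d * ((2 ^ (k * k)) ^ d * n ^ r) ≡⟨ shuffle′ ((4 * K) ^ d) (t ^ d) ((2 ^ (k * k)) ^ d) (n ^ r) ⟩
        (4 * K) ^ d * (2 ^ (k * k)) ^ d * t ^ d * n ^ r   ≡⟨ cong (λ e → e * t ^ d * n ^ r) (^-distribʳ-* (4 * K) (2 ^ (k * k)) d) ⟨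
        β ^ d * t ^ d * n ^ r                         ∎
        where
        shuffle : ∀ a b c → a * (4 * b * c) ≡ 4 * a * b * c
        shuffle = solve-∀
        shuffle′ : ∀ a b c e → a * b * (c * e) ≡ a * c * b * e
        shuffle′ = solve-∀
        ^-swap : ∀ a b c → (a ^ b) ^ c ≡ (a ^ c) ^ b
        ^-swap a b c = trans (^-*-assoc a b c) (trans (cong (a ^_) (*-comm b c)) (sym (^-*-assoc a c b)))
        2k²≤r : 2 * (k * k) ≤ r
        2k²≤r = *-mono-≤ 2≤k (m≤n*m (k * k) 4)
        Y^d≤ : Y ^ d ≤ (2 ^ (k * k)) ^ d * n ^ r
        Y^d≤ = begin
          Y ^ d                                       ≡⟨ ^-swap L (k * k) d ⟩
          (L ^ d) ^ (k * k)                           ≤⟨ ^-monoˡ-≤ (k * k) L^d≤ ⟩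
          (2 ^ d * n ^ 2) ^ (k * k)                   ≡⟨ ^-distribʳ-* (2 ^ d) (n ^ 2) (k * k) ⟩
          (2 ^ d) ^ (k * k) * (n ^ 2) ^ (k * k)       ≡⟨ cong₂ _*_ (^-swap 2 d (k * k)) (^-*-assoc n 2 (k * k)) ⟩
          (2 ^ (k * k)) ^ d * n ^ (2 * (k * k))       ≤⟨ *-monoʳ-≤ ((2 ^ (k * k)) ^ d) (^-monoʳ-≤ n 2k²≤r) ⟩
          (2 ^ (k * k)) ^ d * n ^ r                   ∎

    lower : n ^ (k * d) ≤ β ^ d * t ^ d * n ^ r
    lower with ≤-total d (4 * (k * k))
    ... | inj₁ d≤ = small-degeneracy d≤
    ... | inj₂ ≤d = LargeDegeneracy.large-degeneracy ≤d

-- Real exponents are encoded by clearing denominators. Taking the `s * d`-th root, the first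
-- inequality reads `t ≥ (α / β) n ^ (k - (r / s) / d)`, so `C_k = r / s`; taking the
-- `q * d ^ (k ∸ 1)`-th root, the second reads `t ≤ D n ^ (k - (p / q) / d ^ (k - 1))`, so
-- `c_k = p / q`. All of `r`, `s`, `p`, `q`, `α`, `β` are chosen before `H`.
theorem1p4 : ∀ (k : ℕ) → 2 ≤ k →
    ∃ λ (r : ℕ) → ∃ λ (s : ℕ) → ∃ λ (p : ℕ) → ∃ λ (q : ℕ) →
    ∃ λ (α : ℕ) → ∃ λ (β : ℕ) →
    1 ≤ r × 1 ≤ s × 1 ≤ p × 1 ≤ q × 1 ≤ α × 1 ≤ β ×
    (∀ (m : ℕ) (H : Hypergraph k m) → KPartite H → 2 ≤ e[ H ] →
    ∀ (d : ℕ) → IsSkelDeg H d →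
    (∃ λ (N : ℕ) → ∀ (n t : ℕ) → N ≤ n → IsEx n H t →
    α ^ (s * d) * n ^ (k * (s * d)) ≤ β ^ (s * d) * t ^ (s * d) * n ^ r)
    ×
    (∃ λ (D : ℕ) → ∃ λ (N : ℕ) → ∀ (n t : ℕ) → N ≤ n → IsEx n H t →
    t ^ (q * d ^ (k ∸ 1)) * n ^ p ≤ D ^ (q * d ^ (k ∸ 1)) * n ^ (k * (q * d ^ (k ∸ 1)))))
theorem1p4 k 2≤k =
  lower-exponent k , 1 , 1 , upper-exponent k , 1 , lower-constant k ,
  *-mono-≤ 1≤k (*-mono-≤ (s≤s (z≤n {3})) (*-mono-≤ 1≤k 1≤k)) , ≤-refl , ≤-refl ,
  *-mono-≤ (s≤s (z≤n {3})) (m^n>0 (4 ^ k * suc k) {{m*n≢0 (4 ^ k) (suc k) {{m^n≢0 4 k}}}} (k ∸ 1)) , ≤-refl ,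
  *-mono-≤ (*-mono-≤ (s≤s (z≤n {3})) (*-mono-≤ (m^n>0 2 k) (1≤n! k))) (m^n>0 2 (k * k)) ,
  λ m H kp 2≤e d skel →
    (Lower.N₀ 2≤k H 2≤e d skel , λ n t N≤n ex →
      subst (λ e → 1 ^ e * n ^ (k * e) ≤ lower-constant k ^ e * t ^ e * n ^ lower-exponent k) (sym (*-identityˡ d))
        (≤-trans (≤-reflexive (trans (cong (_* n ^ (k * d)) (^-zeroˡ d)) (*-identityˡ _)))
          (Lower.lower 2≤k H 2≤e d skel N≤n ex))) ,
    (2 , Upper.N₀ 2≤k H kp 2≤e d (skel .proj₁) , Upper.upper 2≤k H kp 2≤e d (skel .proj₁))
  where
  1≤k : 1 ≤ k
  1≤k = ≤-trans (n≤1+n 1) 2≤k
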